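{- For every real $\mu>1$, there is no deterministic $\mu$-robust algorithm for unweighted SPPT with competitive ratio less than $2$. That is, for every $\mu>1$, every deterministic online algorithm $\mathrm{ALG}$ (which may depend on $\mu$) and every $c<2$, there is an unweighted SPPT input $Q$ with $\tilde p_q\le p_q<\mu\,\tilde p_q$ for every $q\in Q$ such that $F^{\mathrm{ALG}}(Q)>c\cdot F^{\mathrm{OPT}}(Q)$.
   Context: Unweighted scheduling with predicted processing time (SPPT), single machine. An input is a finite set $Q$ of jobs; each job $q$ has a processing time $p_q>0$, a release time $r_q\ge 0$, a predicted processing time $\tilde p_q>0$, and weight $1$. At each time the machine processes at most one released, uncompleted job, at unit rate, with preemption allowed. Job $q$ completes at the time $c_q$ at which it has received $p_q$ units of processing. The cost of a schedule is the total flow time $F=\sum_{q\in Q}(c_q-r_q)$. An online algorithm learns of $q$ only at time $r_q$, when it is told $\tilde p_q$ but not $p_q$; it observes completions when they happen, and its decisions at time $t$ depend only on information revealed up to time $t$. $F^{\mathrm{OPT}}(Q)$ is the minimum cost of an offline schedule knowing the entire input. An algorithm with a competitiveness guarantee is $\mu$-robust if the guarantee holds for all inputs with $\tilde p_q\le p_q<\mu\tilde p_q$ for every job $q$. -}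

module Defs where

open import Algebra.Bundles using (CommutativeRing)
import Algebra.Construct.NaturalChoice.Min as Min
import Algebra.Definitions.RawMonoid as RawMonoid
open import Algebra.Structures using (IsCommutativeRing)
open import Data.Fin.Base using (Fin; toℕ)
open import Data.Fin.Properties using (_≟_)
open import Data.Maybe.Base using (Maybe; just; nothing; map)
open import Data.Nat.Base using (ℕ; zero; suc)
open import Data.Product.Base using (Σ-syntax; ∃-syntax; _×_; proj₁)
open import Level using (0ℓ) renaming (suc to lsuc)
open import Relation.Binary.Bundles using (StrictTotalOrder; TotalOrder; DecTotalOrder)
import Relation.Binary.Construct.StrictToNonStrict as StrictToNonStrict
open import Relation.Binary.PropositionalEquality using (_≡_; _≢_)
import Relation.Binary.Properties.StrictTotalOrder as STOProperties
open import Relation.Binary.Structures using (IsStrictTotalOrder)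
open import Relation.Nullary using (yes; no)
open import Relation.Unary using (Pred; Satisfiable; _≐_)

-- A complete ordered field.  Classically ℝ is the only one up to isomorphism.
-- The Archimedean property then follows from completeness; it is a field of
-- the record because that derivation needs excluded middle.
record RealField : Set (lsuc 0ℓ) where
  infix  8 -_
  infixl 7 _*_
  infixl 6 _+_
  infix  4 _<_

  field
    ℝ                  : Set
    _+_ _*_            : ℝ → ℝ → ℝ
    -_                 : ℝ → ℝ
    0# 1#              : ℝ
    isCommutativeRing  : IsCommutativeRing _≡_ _+_ _*_ -_ 0# 1#
    0≢1                : 0# ≢ 1#
    inverse            : ∀ x → x ≢ 0# → ∃[ y ] x * y ≡ 1#
    _<_                : ℝ → ℝ → Set
    isStrictTotalOrder : IsStrictTotalOrder _≡_ _<_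
    +-monoˡ-<          : ∀ z {x y} → x < y → x + z < y + z
    *-pos              : ∀ {x y} → 0# < x → 0# < y → 0# < x * y

  commutativeRing : CommutativeRing 0ℓ 0ℓ
  commutativeRing = record { isCommutativeRing = isCommutativeRing }

  strictTotalOrder : StrictTotalOrder 0ℓ 0ℓ 0ℓ
  strictTotalOrder = record { isStrictTotalOrder = isStrictTotalOrder }

  totalOrder : TotalOrder 0ℓ 0ℓ 0ℓ
  totalOrder = DecTotalOrder.totalOrder (STOProperties.decTotalOrder strictTotalOrder)

  open StrictToNonStrict _≡_ _<_ public using (_≤_)
  open Min totalOrder public using (_⊓_)
  open RawMonoid (CommutativeRing.+-rawMonoid commutativeRing) public
    using (sum) renaming (_×_ to _·_)

  UpperBound : Pred ℝ 0ℓ → ℝ → Set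
  UpperBound P b = ∀ x → P x → x ≤ b

  field
    archimedean : ∀ x y → 0# < x → ∃[ n ] y < n · x
    complete    : (P : Pred ℝ 0ℓ) → Satisfiable P → Satisfiable (UpperBound P) →
                  ∃[ s ] UpperBound P s × (∀ b → UpperBound P b → s ≤ b)

  infixl 6 _-_
  _-_ : ℝ → ℝ → ℝ
  x - y = x + (- y)

module SPPT (R : RealField) where
  open RealField R

  record Job : Set where
    field
      processing : ℝ
      release    : ℝ
      predicted  : ℝ
      processing-pos : 0# < processing
      release-nonneg : 0# ≤ release
      predicted-pos  : 0# < predicted

  open Job public

  record Input : Set where
    field
      size : ℕ
      job  : Fin size → Job

  open Input public

  Robust : ℝ → Input → Set
  Robust μ Q = ∀ q → predicted (job Q q) ≤ processing (job Q q)
                   × processing (job Q q) < μ * predicted (job Q q)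

  -- A schedule for n jobs with finitely many preemptions in bounded time: the
  -- machine runs `slot k` (`nothing` = idle) throughout [ cut k , cut (suc k) ).
  -- Since the cuts are unbounded these intervals partition [ 0 , ∞ ).
  record Schedule (n : ℕ) : Set where
    field
      cut           : ℕ → ℝ
      cut-zero      : cut zero ≡ 0#
      cut-mono      : ∀ k → cut k < cut (suc k)
      cut-unbounded : ∀ t → ∃[ k ] t < cut k
      slot          : ℕ → Maybe (Fin n)

    Runs : ℝ → Maybe (Fin n) → Set
    Runs t d = ∃[ k ] cut k ≤ t × t < cut (suc k) × slot k ≡ d

    -- For t ≥ 0, the length of
    -- [ cut k , cut (suc k) ) ∩ [ 0 , t ).
    slotLength : ℕ → ℝ → ℝ
    slotLength k t = (t ⊓ cut (suc k)) - (t ⊓ cut k)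

    slotWork : Maybe (Fin n) → Fin n → ℝ → ℝ
    slotWork nothing  q ℓ = 0#
    slotWork (just r) q ℓ with r ≟ q
    ... | yes _ = ℓ
    ... | no  _ = 0#

    workIn : ℕ → Fin n → ℝ → ℝ
    workIn zero    q t = 0#
    workIn (suc k) q t = workIn k q t + slotWork (slot k) q (slotLength k t)

    -- Processing received by q before time t.  Slots starting at or after t
    -- contribute 0, so any k with t < cut k gives the same value.
    work : Fin n → ℝ → ℝ
    work q t = workIn (proj₁ (cut-unbounded t)) q t

  open Schedule public using (Runs; work)

  module _ (Q : Input) (S : Schedule (size Q)) where

    -- Only released, uncompleted jobs are run.  Completing every job is not
    -- required.
    Valid : Set
    Valid = ∀ t q → Runs S t (just q) →
            release (job Q q) ≤ t × work S q t < processing (job Q q)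

    CompletesAt : Fin (size Q) → ℝ → Set
    CompletesAt q c = work S q c ≡ processing (job Q q)
                    × (∀ t → t < c → work S q t < processing (job Q q))

    -- Satisfied by no F when some job never completes.
    TotalFlow : ℝ → Set
    TotalFlow F = Σ[ c ∈ (Fin (size Q) → ℝ) ]
                    (∀ q → CompletesAt q (c q))
                    × F ≡ sum (λ q → c q - release (job Q q))

    -- The total flow is > x, counting it as +∞ when some job never completes.
    TotalFlowExceeds : ℝ → Set
    TotalFlowExceeds x = ∀ F → TotalFlow F → x < F

  IsOPT : Input → ℝ → Set
  IsOPT Q v = (∃[ S ] Valid Q S × TotalFlow Q S v)
            × (∀ S w → Valid Q S → TotalFlow Q S w → v ≤ w)

  -- Jobs are named by their index, which makes sense across different inputs.
  data Event : Set where
    released  : (name : ℕ) (time prediction : ℝ) → Event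
    completed : (name : ℕ) (time : ℝ) → Event

  -- The information revealed up to time t when Q is scheduled by S.
  Revealed : (Q : Input) → Schedule (size Q) → ℝ → Pred Event 0ℓ
  Revealed Q S t (released i r p̃) =
    r ≤ t × (∃[ q ] toℕ q ≡ i × release (job Q q) ≡ r × predicted (job Q q) ≡ p̃)
  Revealed Q S t (completed i c) =
    c ≤ t × (∃[ q ] toℕ q ≡ i × CompletesAt Q S q c)

  Decision : ∀ {n} → Schedule n → ℝ → Pred (Maybe ℕ) 0ℓ
  Decision S t d = ∃[ j ] Runs S t j × map toℕ j ≡ d

  -- A deterministic online algorithm, as the map from inputs to the schedules
  -- it produces: whenever two runs have revealed the same information up to
  -- time t, they make the same decision at time t.
  record OnlineAlgorithm : Set where
    field
      run    : (Q : Input) → Schedule (size Q)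
      valid  : ∀ Q → Valid Q (run Q)
      online : ∀ Q Q′ t → Revealed Q (run Q) t ≐ Revealed Q′ (run Q′) t →
               Decision (run Q) t ≐ Decision (run Q′) t

  open OnlineAlgorithm public using (run)

{-# OPTIONS --safe #-}
module Submission where

-- Fix K ≥ 2 with B / K < μ, where B = K + 1.  The adversary releases k pairs of
-- jobs at geometrically decreasing scales.  Both jobs of the pair of level ℓ are
-- predicted to take K B^ℓ; one of them, the short job, does, while the other, the
-- long job, takes B^(ℓ+1).  The levels k-1, ..., 0 follow each other, level ℓ
-- occupying a time window of length K B^ℓ, and are followed by a stream of n unit
-- jobs, released one per unit of time.
--
-- Which job of a pair is short is decided at the end of its window: the one that
-- has been processed less.  Before that moment no job can have completed, so the
-- algorithm cannot have told the two cases apart (indistinguishable).  The short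
-- job has received at most half of its processing time, so both jobs still need at
-- least B^ℓ, more than the B^ℓ - 1 that the lower levels last together.  Hence
-- when the stream starts, the 2k jobs of the pairs all need at least one more unit
-- of processing (adversary).  From then on every completion costs a unit of
-- machine time, so the online algorithm cannot get rid of its backlog while the
-- stream lasts, and its total flow time is at least (2k+1) n (online-flow).
--
-- The offline schedule runs the short job of every pair in its window, then every
-- job of the stream as it is released, then the long jobs in increasing order.
-- Its total flow time is (k+1) n + A, where A does not depend on n (sum-flow).  It
-- is optimal, because no schedule completes j jobs before the time at which this
-- one completes its j-th job (feasible-late), and because such bounds on the
-- completion times of sets of jobs add up to a bound on their sum (sum-≥).
--
-- If k (2 - c) > 2 and n = 2A + 1, then (2k+1) n > c ((k+1) n + A) (ratio).

open import Algebra.Bundles using (CommutativeRing)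
import Algebra.Construct.NaturalChoice.Min as Min
import Algebra.Construct.NaturalChoice.MinOp as MinOp
import Algebra.Properties.CommutativeMonoid.Sum as CommutativeMonoidSum
import Algebra.Properties.Monoid.Mult as MonoidMult
import Algebra.Properties.Ring as RingProperties
import Algebra.Properties.Semiring.Mult as SemiringMult
import Algebra.Solver.Ring.NaturalCoefficients.Default as SemiringSolver
open import Data.Bool.Base using (Bool; true; false)
open import Data.Empty using (⊥; ⊥-elim)
open import Data.Fin.Base using (Fin; zero; suc; toℕ; fromℕ<)
import Data.Fin.Properties as Fin
open import Data.Fin.Subset using (Subset; inside; outside; _∈_; ∣_∣; ⊤; ⁅_⁆; _∪_; Nonempty)
import Data.Fin.Subset as Subset using (⊥)
import Data.Fin.Subset.Properties as Subset
open import Data.Maybe.Base using (Maybe; just; nothing)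
import Data.Maybe.Base as Maybe using (map)
import Data.Maybe.Properties as Maybe
open import Data.Nat.Base as ℕ using (ℕ; zero; suc; z≤n; s≤s)
import Data.Nat.Properties as ℕ
open import Data.Nat.Solver using (module +-*-Solver)
open import Data.Product.Base using (Σ-syntax; ∃-syntax; _×_; _,_; proj₁; proj₂)
open import Data.Sum.Base using (_⊎_; inj₁; inj₂)
open import Data.Vec.Base using (Vec; []; _∷_; here; there; replicate)
open import Function.Base using (_∘_)
open import Relation.Binary.Bundles using (StrictTotalOrder; DecTotalOrder)
open import Relation.Binary.Definitions using (tri<; tri≈; tri>)
open import Relation.Binary.PropositionalEquality
  using (_≡_; _≢_; refl; sym; trans; cong; cong₂; subst; subst₂; module ≡-Reasoning)
import Relation.Binary.Properties.StrictTotalOrder as STOProperties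
import Relation.Binary.Reasoning.StrictPartialOrder as StrictPartialOrderReasoning
open import Relation.Nullary using (yes; no)
open import Relation.Unary using (_≐_; _⊆_)
open import Defs

open +-*-Solver using ()
  renaming (solve to solveℕ; _:+_ to _⊕_; _:*_ to _⊗_; _:=_ to _⊜_; con to κ)

-- Ordered field arithmetic

module OrderedField (R : RealField) where
  open RealField R

  module 𝔽 = CommutativeRing commutativeRing
  module Order = StrictTotalOrder strictTotalOrder
  module NonStrict = DecTotalOrder (STOProperties.decTotalOrder strictTotalOrder)
  module Solver = SemiringSolver 𝔽.commutativeSemiring
  open Solver using (solve; _:+_; _:*_; _:=_; con)
  module ≤-Reasoning = StrictPartialOrderReasoning Order.strictPartialOrder
  module ⊓ = MinOp (Min.minOperator totalOrder)

  ≤-refl : ∀ {x} → x ≤ x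
  ≤-refl = inj₂ refl

  ≤-reflexive : ∀ {x y} → x ≡ y → x ≤ y
  ≤-reflexive = inj₂

  ≤-trans : ∀ {x y z} → x ≤ y → y ≤ z → x ≤ z
  ≤-trans = NonStrict.trans

  <⇒≤ : ∀ {x y} → x < y → x ≤ y
  <⇒≤ = inj₁

  <-irrefl : ∀ {x} → x < x → ⊥
  <-irrefl = Order.irrefl refl

  <-≤-trans : ∀ {x y z} → x < y → y ≤ z → x < z
  <-≤-trans x<y (inj₁ y<z)  = Order.trans x<y y<z
  <-≤-trans x<y (inj₂ refl) = x<y

  ≤-<-trans : ∀ {x y z} → x ≤ y → y < z → x < z
  ≤-<-trans (inj₁ x<y)  y<z = Order.trans x<y y<z
  ≤-<-trans (inj₂ refl) y<z = y<z

  ≤⇒≯ : ∀ {x y} → x ≤ y → y < x → ⊥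
  ≤⇒≯ x≤y y<x = <-irrefl (≤-<-trans x≤y y<x)

  <-≤-total : ∀ x y → x < y ⊎ y ≤ x
  <-≤-total x y with Order.compare x y
  ... | tri< x<y _ _ = inj₁ x<y
  ... | tri≈ _ x≡y _ = inj₂ (inj₂ (sym x≡y))
  ... | tri> _ _ y<x = inj₂ (inj₁ y<x)

  +-monoʳ-< : ∀ z {x y} → x < y → z + x < z + y
  +-monoʳ-< z x<y = subst₂ _<_ (𝔽.+-comm _ z) (𝔽.+-comm _ z) (+-monoˡ-< z x<y)

  +-monoˡ-≤ : ∀ z {x y} → x ≤ y → x + z ≤ y + z
  +-monoˡ-≤ z (inj₁ x<y)  = inj₁ (+-monoˡ-< z x<y)
  +-monoˡ-≤ z (inj₂ refl) = ≤-refl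

  +-monoʳ-≤ : ∀ z {x y} → x ≤ y → z + x ≤ z + y
  +-monoʳ-≤ z x≤y = subst₂ _≤_ (𝔽.+-comm _ z) (𝔽.+-comm _ z) (+-monoˡ-≤ z x≤y)

  +-mono-≤ : ∀ {x y u v} → x ≤ y → u ≤ v → x + u ≤ y + v
  +-mono-≤ {y = y} {u} x≤y u≤v = ≤-trans (+-monoˡ-≤ u x≤y) (+-monoʳ-≤ y u≤v)

  +-mono-<-≤ : ∀ {x y u v} → x < y → u ≤ v → x + u < y + v
  +-mono-<-≤ {y = y} {u} x<y u≤v = <-≤-trans (+-monoˡ-< u x<y) (+-monoʳ-≤ y u≤v)

  x+z-z≡x : ∀ x z → x + z + (- z) ≡ x
  x+z-z≡x x z = trans (𝔽.+-assoc x z _) (trans (cong (x +_) (𝔽.-‿inverseʳ z)) (𝔽.+-identityʳ x))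

  x-z+z≡x : ∀ x z → x - z + z ≡ x
  x-z+z≡x x z = trans (𝔽.+-assoc x _ z) (trans (cong (x +_) (𝔽.-‿inverseˡ z)) (𝔽.+-identityʳ x))

  x-x≡0 : ∀ x → x - x ≡ 0#
  x-x≡0 = 𝔽.-‿inverseʳ

  +-cancelʳ-≤ : ∀ z {x y} → x + z ≤ y + z → x ≤ y
  +-cancelʳ-≤ z {x} {y} h = subst₂ _≤_ (x+z-z≡x x z) (x+z-z≡x y z) (+-monoˡ-≤ (- z) h)

  +-cancelʳ-< : ∀ z {x y} → x + z < y + z → x < y
  +-cancelʳ-< z {x} {y} h = subst₂ _<_ (x+z-z≡x x z) (x+z-z≡x y z) (+-monoˡ-< (- z) h)

  -- An inequality follows from another one when the cross sums of their sides agree.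
  ≤-transfer : ∀ {x y a b} → a ≤ b → x + b ≡ y + a → x ≤ y
  ≤-transfer {x} {y} {a} {b} a≤b eq =
    +-cancelʳ-≤ a (≤-trans (+-monoʳ-≤ x a≤b) (≤-reflexive eq))

  x+y≡z⇒x≡z-y : ∀ {x y z} → x + y ≡ z → x ≡ z - y
  x+y≡z⇒x≡z-y {x} {y} eq = trans (sym (x+z-z≡x x y)) (cong (_+ (- y)) eq)

  -- 1 is positive: otherwise -1 is, and so is (-1)(-1) = 1.
  0<1 : 0# < 1#
  0<1 with Order.compare 0# 1#
  ... | tri< 0<1 _ _ = 0<1
  ... | tri≈ _ 0≡1 _ = ⊥-elim (0≢1 0≡1)
  ... | tri> _ _ 1<0 = ⊥-elim (<-irrefl (Order.trans 1<0 (subst (0# <_) square (*-pos 0<-1 0<-1))))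
    where
    open RingProperties 𝔽.ring using (-1*x≈-x; -‿involutive)
    0<-1 : 0# < - 1#
    0<-1 = subst₂ _<_ (𝔽.-‿inverseʳ 1#) (𝔽.+-identityˡ _) (+-monoˡ-< (- 1#) 1<0)
    square : - 1# * - 1# ≡ 1#
    square = trans (-1*x≈-x (- 1#)) (-‿involutive 1#)

  *-monoʳ-< : ∀ z {x y} → 0# < z → x < y → z * x < z * y
  *-monoʳ-< z {x} {y} 0<z x<y =
    subst₂ _<_ (𝔽.+-identityˡ _) factor (+-monoˡ-< (z * x) (*-pos 0<z 0<y-x))
    where
    0<y-x : 0# < y - x
    0<y-x = subst (_< y - x) (x-x≡0 x) (+-monoˡ-< (- x) x<y)
    factor : z * (y - x) + z * x ≡ z * y
    factor = trans (sym (𝔽.distribˡ z _ x)) (cong (z *_) (x-z+z≡x y x))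

  *-monoʳ-≤ : ∀ z {x y} → 0# < z → x ≤ y → z * x ≤ z * y
  *-monoʳ-≤ z 0<z (inj₁ x<y)  = inj₁ (*-monoʳ-< z 0<z x<y)
  *-monoʳ-≤ z 0<z (inj₂ refl) = ≤-refl

  -- The embedding of the natural numbers.
  ι : ℕ → ℝ
  ι n = n · 1#

  ι-+ : ∀ m n → ι (m ℕ.+ n) ≡ ι m + ι n
  ι-+ = MonoidMult.×-homo-+ 𝔽.+-monoid 1#

  ι-* : ∀ m n → ι (m ℕ.* n) ≡ ι m * ι n
  ι-* = SemiringMult.×1-homo-* 𝔽.semiring

  ι-1 : ι 1 ≡ 1#
  ι-1 = 𝔽.+-identityʳ 1#

  ι-suc-< : ∀ n → ι n < ι (suc n)
  ι-suc-< n = subst (_< ι (suc n)) (𝔽.+-identityˡ (ι n)) (+-monoˡ-< (ι n) 0<1)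

  ι-mono-≤ : ∀ {m n} → m ℕ.≤ n → ι m ≤ ι n
  ι-mono-≤ {zero}  {zero}  z≤n       = ≤-refl
  ι-mono-≤ {zero}  {suc n} z≤n       = ≤-trans (ι-mono-≤ {zero} {n} z≤n) (<⇒≤ (ι-suc-< n))
  ι-mono-≤ {suc m} {suc n} (s≤s m≤n) = +-monoʳ-≤ 1# (ι-mono-≤ m≤n)

  ι-mono-< : ∀ {m n} → m ℕ.< n → ι m < ι n
  ι-mono-< {m} m<n = <-≤-trans (ι-suc-< m) (ι-mono-≤ m<n)

  ι-nonneg : ∀ n → 0# ≤ ι n
  ι-nonneg n = ι-mono-≤ {0} {n} z≤n

  ⊓-≤ : ∀ {x y} → x ≤ y → x ⊓ y ≡ x
  ⊓-≤ = Min.x≤y⇒x⊓y≈x totalOrder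

  ⊓-≥ : ∀ {x y} → y ≤ x → x ⊓ y ≡ y
  ⊓-≥ = Min.x≤y⇒y⊓x≈x totalOrder

  ⊓-monoˡ-≤ : ∀ z {x y} → x ≤ y → x ⊓ z ≤ y ⊓ z
  ⊓-monoˡ-≤ z = ⊓.⊓-monoˡ-≤ z

  ⊓-monoʳ-≤ : ∀ z {x y} → x ≤ y → z ⊓ x ≤ z ⊓ y
  ⊓-monoʳ-≤ z = ⊓.⊓-monoʳ-≤ z

-- Sums over finite sets of jobs

module FiniteSums (R : RealField) where
  open RealField R
  open OrderedField R
  open Solver using (solve; _:+_; _:*_; _:=_; con)

  sum-mono-≤ : ∀ {m} {f g : Fin m → ℝ} → (∀ q → f q ≤ g q) → sum f ≤ sum g
  sum-mono-≤ {zero}  f≤g = ≤-refl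
  sum-mono-≤ {suc m} f≤g = +-mono-≤ (f≤g zero) (sum-mono-≤ (f≤g ∘ suc))

  sum-+ : ∀ {m} (f g : Fin m → ℝ) → sum (λ q → f q + g q) ≡ sum f + sum g
  sum-+ = CommutativeMonoidSum.∑-distrib-+ 𝔽.+-commutativeMonoid

  sum-cong : ∀ {m} {f g : Fin m → ℝ} → (∀ q → f q ≡ g q) → sum f ≡ sum g
  sum-cong = CommutativeMonoidSum.sum-cong-≋ 𝔽.+-commutativeMonoid

  -- The sum of f over the elements of J.
  sumOver : ∀ {m} → Subset m → (Fin m → ℝ) → ℝ
  sumOver []            f = 0#
  sumOver (inside  ∷ J) f = f zero + sumOver J (f ∘ suc)
  sumOver (outside ∷ J) f = sumOver J (f ∘ suc)

  sumOver-⊤ : ∀ {m} (f : Fin m → ℝ) → sumOver ⊤ f ≡ sum f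
  sumOver-⊤ {zero}  f = refl
  sumOver-⊤ {suc m} f = cong (f zero +_) (sumOver-⊤ (f ∘ suc))

  sumOver-mono-≤ : ∀ {m} (J : Subset m) {f g : Fin m → ℝ} →
                   (∀ q → q ∈ J → f q ≤ g q) → sumOver J f ≤ sumOver J g
  sumOver-mono-≤ []            f≤g = ≤-refl
  sumOver-mono-≤ (inside  ∷ J) f≤g = 
    +-mono-≤ (f≤g zero here) (sumOver-mono-≤ J (λ q q∈J → f≤g (suc q) (there q∈J)))
  sumOver-mono-≤ (outside ∷ J) f≤g = sumOver-mono-≤ J (λ q q∈J → f≤g (suc q) (there q∈J))

  sumOver-+ : ∀ {m} (J : Subset m) (f g : Fin m → ℝ) →
              sumOver J (λ q → f q + g q) ≡ sumOver J f + sumOver J g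
  sumOver-+ []            f g = sym (𝔽.+-identityˡ 0#)
  sumOver-+ (inside  ∷ J) f g = trans (cong (f zero + g zero +_) (sumOver-+ J (f ∘ suc) (g ∘ suc)))
    (solve 4 (λ a b c d → a :+ b :+ (c :+ d) := a :+ c :+ (b :+ d)) refl _ _ _ _)
  sumOver-+ (outside ∷ J) f g = sumOver-+ J (f ∘ suc) (g ∘ suc)

  sumOver-0 : ∀ {m} (J : Subset m) → sumOver J (λ _ → 0#) ≡ 0#
  sumOver-0 []            = refl
  sumOver-0 (inside  ∷ J) = trans (𝔽.+-identityˡ _) (sumOver-0 J)
  sumOver-0 (outside ∷ J) = sumOver-0 J

  sumOver-1 : ∀ {m} (J : Subset m) → sumOver J (λ _ → 1#) ≡ ι ∣ J ∣
  sumOver-1 []            = refl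
  sumOver-1 (inside  ∷ J) = cong (1# +_) (sumOver-1 J)
  sumOver-1 (outside ∷ J) = sumOver-1 J

  sumOver-cong : ∀ {m} (J : Subset m) {f g : Fin m → ℝ} → (∀ q → f q ≡ g q) → sumOver J f ≡ sumOver J g
  sumOver-cong []            f≡g = refl
  sumOver-cong (inside  ∷ J) f≡g = cong₂ _+_ (f≡g zero) (sumOver-cong J (f≡g ∘ suc))
  sumOver-cong (outside ∷ J) f≡g = sumOver-cong J (f≡g ∘ suc)

  -- If f and g differ in one summand only, and f i - g i ≤ a - b with b ≤ a,
  -- then the sums over J differ by at most a - b, whether or not i is in J.
  sumOver-change : ∀ {m} (J : Subset m) {f g : Fin m → ℝ} (i : Fin m) {a b : ℝ} →
                   (∀ q → q ≢ i → f q ≡ g q) → f i + b ≤ g i + a → b ≤ a →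
                   sumOver J f + b ≤ sumOver J g + a
  sumOver-change (inside ∷ J) {f} {g} zero {a} {b} f≡g h b≤a = begin
    f zero + sumOver J (f ∘ suc) + b    ≡⟨ solve 3 (λ x y b → x :+ y :+ b := x :+ b :+ y) refl _ _ _ ⟩
    f zero + b + sumOver J (f ∘ suc)    ≡⟨ cong (f zero + b +_) (sumOver-cong J (λ q → f≡g (suc q) (λ ()))) ⟩
    f zero + b + sumOver J (g ∘ suc)    ≤⟨ +-monoˡ-≤ _ h ⟩
    g zero + a + sumOver J (g ∘ suc)    ≡⟨ solve 3 (λ x y b → x :+ b :+ y := x :+ y :+ b) refl _ _ _ ⟩
    g zero + sumOver J (g ∘ suc) + a    ∎
    where open ≤-Reasoning
  sumOver-change (outside ∷ J) zero f≡g h b≤a =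
    +-mono-≤ (≤-reflexive (sumOver-cong J (λ q → f≡g (suc q) (λ ())))) b≤a
  sumOver-change (inside ∷ J) {f} {g} (suc i) {a} {b} f≡g h b≤a = begin
    f zero + sumOver J (f ∘ suc) + b    ≡⟨ 𝔽.+-assoc _ _ _ ⟩
    f zero + (sumOver J (f ∘ suc) + b)  ≤⟨ +-mono-≤ (≤-reflexive (f≡g zero (λ ())))
                                             (sumOver-change J i (λ q q≢i → f≡g (suc q) (λ { refl → q≢i refl })) h b≤a) ⟩
    g zero + (sumOver J (g ∘ suc) + a)  ≡⟨ 𝔽.+-assoc _ _ _ ⟨
    g zero + sumOver J (g ∘ suc) + a    ∎
    where open ≤-Reasoning
  sumOver-change (outside ∷ J) (suc i) f≡g h b≤a =
    sumOver-change J i (λ q q≢i → f≡g (suc q) (λ { refl → q≢i refl })) h b≤a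

  sumOver-remove : ∀ {m} {J : Subset m} {q} → q ∈ J →
    ∃[ J′ ] ∣ J ∣ ≡ suc ∣ J′ ∣ × (∀ f → sumOver J f ≡ sumOver J′ f + f q)
  sumOver-remove {J = inside ∷ J} here = outside ∷ J , refl , λ f → 𝔽.+-comm _ _
  sumOver-remove {J = inside ∷ J} (there q∈J) with sumOver-remove q∈J
  ... | J′ , size≡ , sum≡ = inside ∷ J′ , cong suc size≡ ,
        λ f → trans (cong (f zero +_) (sum≡ (f ∘ suc))) (sym (𝔽.+-assoc _ _ _))
  sumOver-remove {J = outside ∷ J} (there q∈J) with sumOver-remove q∈J
  ... | J′ , size≡ , sum≡ = outside ∷ J′ , size≡ , λ f → sum≡ (f ∘ suc)

  nonempty : ∀ {m k} (J : Subset m) → ∣ J ∣ ≡ suc k → Nonempty J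
  nonempty (inside  ∷ J) _  = zero , here
  nonempty (outside ∷ J) eq with nonempty J eq
  ... | q , q∈J = suc q , there q∈J

  empty-or-nonempty : ∀ {m} (J : Subset m) → ∣ J ∣ ≡ 0 ⊎ Nonempty J
  empty-or-nonempty J with ∣ J ∣ in eq
  ... | zero  = inj₁ refl
  ... | suc _ = inj₂ (nonempty J eq)

  argmax : ∀ {m} (J : Subset m) (f : Fin m → ℝ) → Nonempty J →
           ∃[ q ] q ∈ J × (∀ q′ → q′ ∈ J → f q′ ≤ f q)
  argmax (b ∷ J) f ne with empty-or-nonempty J
  argmax (inside  ∷ J) f ne | inj₁ e = zero , here , λ
    { zero here → ≤-refl ; (suc q′) (there q′∈J) → ⊥-elim (absurd e q′∈J) }
    where
    absurd : ∀ {q} → ∣ J ∣ ≡ 0 → q ∈ J → ⊥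
    absurd e q∈J with sumOver-remove q∈J
    ... | _ , size≡ , _ with trans (sym e) size≡
    ... | ()
  argmax (outside ∷ J) f (suc q , there q∈J) | inj₁ e with sumOver-remove q∈J
  ... | _ , size≡ , _ with trans (sym e) size≡
  ... | ()
  argmax (b ∷ J) f _ | inj₂ ne with argmax J (f ∘ suc) ne
  argmax (outside ∷ J) f _ | inj₂ _ | q , q∈J , max =
    suc q , there q∈J , λ { (suc q′) (there q′∈J) → max q′ q′∈J }
  argmax (inside ∷ J) f _ | inj₂ _ | q , q∈J , max with <-≤-total (f zero) (f (suc q))
  ... | inj₁ f₀<f = suc q , there q∈J , λ
    { zero here → <⇒≤ f₀<f ; (suc q′) (there q′∈J) → max q′ q′∈J }
  ... | inj₂ f≤f₀ = zero , here , λ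
    { zero here → ≤-refl ; (suc q′) (there q′∈J) → ≤-trans (max q′ q′∈J) f≤f₀ }

  -- The sum f 0 + ... + f (m - 1).
  Σ< : ℕ → (ℕ → ℝ) → ℝ
  Σ< zero    f = 0#
  Σ< (suc m) f = Σ< m f + f m

  Σ<-cons : ∀ m f → Σ< (suc m) f ≡ f 0 + Σ< m (f ∘ suc)
  Σ<-cons zero    f = 𝔽.+-comm _ _
  Σ<-cons (suc m) f = trans (cong (_+ f (suc m)) (Σ<-cons m f)) (𝔽.+-assoc _ _ _)

  -- If the last completion time in every set of j elements is at least g j, then
  -- the completion times of k elements sum to at least g 1 + ... + g k: remove the
  -- element completed last and induct.
  sumOver-≥ : ∀ {m} (c : Fin m → ℝ) (g : ℕ → ℝ) →
              (∀ J t → Nonempty J → (∀ q → q ∈ J → c q ≤ t) → g ∣ J ∣ ≤ t) →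
              ∀ k J → ∣ J ∣ ≡ k → Σ< k (g ∘ suc) ≤ sumOver J c
  sumOver-≥ c g late zero    J eq = ≤-reflexive (sym (empty J eq))
    where
    empty : ∀ {m} (J : Subset m) {c : Fin m → ℝ} → ∣ J ∣ ≡ 0 → sumOver J c ≡ 0#
    empty []            _  = refl
    empty (outside ∷ J) eq = empty J eq
  sumOver-≥ c g late (suc k) J eq with argmax J c (nonempty J eq)
  ... | q , q∈J , max with sumOver-remove q∈J
  ... | J′ , size≡ , sum≡ = begin
    Σ< k (g ∘ suc) + g (suc k)  ≤⟨ +-mono-≤ (sumOver-≥ c g late k J′ (ℕ.suc-injective (trans (sym size≡) eq)))
                                    (subst (λ m → g m ≤ c q) eq (late J (c q) (q , q∈J) max)) ⟩
    sumOver J′ c + c q          ≡⟨ sum≡ c ⟨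
    sumOver J c                 ∎
    where open ≤-Reasoning

  sum-≥ : ∀ {m} (c : Fin m → ℝ) (g : ℕ → ℝ) →
          (∀ J t → Nonempty J → (∀ q → q ∈ J → c q ≤ t) → g ∣ J ∣ ≤ t) →
          Σ< m (g ∘ suc) ≤ sum c
  sum-≥ {m} c g late = subst (Σ< m (g ∘ suc) ≤_) (sumOver-⊤ c) (sumOver-≥ c g late m ⊤ (Subset.∣⊤∣≡n m))

-- Work done by a schedule

module ScheduleProperties (R : RealField) where
  open RealField R
  open OrderedField R
  open FiniteSums R
  open SPPT R
  open Solver using (solve; _:+_; _:*_; _:=_; con)

  sumOver-⁅⁆ : ∀ {m} (q : Fin m) (f : Fin m → ℝ) → sumOver ⁅ q ⁆ f ≡ f q
  sumOver-⁅⁆ zero f = trans (cong (f zero +_) (over-⊥ (f ∘ suc))) (𝔽.+-identityʳ _)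
    where
    over-⊥ : ∀ {m} (f : Fin m → ℝ) → sumOver Subset.⊥ f ≡ 0#
    over-⊥ {zero}  f = refl
    over-⊥ {suc m} f = over-⊥ (f ∘ suc)
  sumOver-⁅⁆ (suc q) f = sumOver-⁅⁆ q (f ∘ suc)

  sumOver-pair : ∀ {m} {a b : Fin m} → a ≢ b → (f : Fin m → ℝ) → sumOver (⁅ a ⁆ ∪ ⁅ b ⁆) f ≡ f a + f b
  sumOver-pair {a = zero}  {zero}  a≢b f = ⊥-elim (a≢b refl)
  sumOver-pair {a = zero}  {suc b} a≢b f = cong (f zero +_)
    (trans (cong (λ J → sumOver J (f ∘ suc)) (Subset.∪-identityˡ ⁅ b ⁆)) (sumOver-⁅⁆ b (f ∘ suc)))
  sumOver-pair {a = suc a} {zero}  a≢b f = trans (cong (f zero +_)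
    (trans (cong (λ J → sumOver J (f ∘ suc)) (Subset.∪-identityʳ ⁅ a ⁆)) (sumOver-⁅⁆ a (f ∘ suc)))) (𝔽.+-comm _ _)
  sumOver-pair {a = suc a} {suc b} a≢b f = sumOver-pair (λ { refl → a≢b refl }) (f ∘ suc)

  module _ {m : ℕ} (S : Schedule m) where
    open Schedule S hiding (Runs; work)

    cut-mono-≤ : ∀ {i j} → i ℕ.≤ j → cut i ≤ cut j
    cut-mono-≤ {i} {zero}  z≤n = ≤-refl
    cut-mono-≤ {i} {suc j} i≤j with ℕ.m≤n⇒m<n∨m≡n i≤j
    ... | inj₁ (s≤s i≤j′) = ≤-trans (cut-mono-≤ i≤j′) (<⇒≤ (cut-mono j))
    ... | inj₂ refl       = ≤-refl

    Runs-slot : ∀ {k t} → cut k ≤ t → t < cut (suc k) → Runs S t (slot k)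
    Runs-slot {k} ≤t t< = k , ≤t , t< , refl

    Runs-unique : ∀ {t d d′} → Runs S t d → Runs S t d′ → d ≡ d′
    Runs-unique (k , k≤ , <k , refl) (k′ , k′≤ , <k′ , refl) = cong slot (ℕ.≤-antisym
      (index-≤ k≤ <k′) (index-≤ k′≤ <k))
      where
      index-≤ : ∀ {t k k′} → cut k ≤ t → t < cut (suc k′) → k ℕ.≤ k′
      index-≤ {k = k} {k′} ≤t t< with k ℕ.≤? k′
      ... | yes k≤k′ = k≤k′
      ... | no  k≰k′ = ⊥-elim (≤⇒≯ (≤-trans (cut-mono-≤ (ℕ.≰⇒> k≰k′)) ≤t) t<)

    slotLength-before : ∀ {k t} → t ≤ cut k → slotLength k t ≡ 0#
    slotLength-before {k} {t} t≤ = trans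
      (cong₂ _-_ (⊓-≤ (≤-trans t≤ (<⇒≤ (cut-mono k)))) (⊓-≤ t≤)) (x-x≡0 t)

    slotLength-within : ∀ {k t} → cut k ≤ t → t ≤ cut (suc k) → slotLength k t ≡ t - cut k
    slotLength-within ≤t t≤ = cong₂ _-_ (⊓-≤ t≤) (⊓-≥ ≤t)

    slotLength-after : ∀ {k t} → cut (suc k) ≤ t → slotLength k t ≡ cut (suc k) - cut k
    slotLength-after {k} ≤t = cong₂ _-_ (⊓-≥ ≤t) (⊓-≥ (≤-trans (<⇒≤ (cut-mono k)) ≤t))

    slotLength-+ : ∀ k t → slotLength k t + t ⊓ cut k ≡ t ⊓ cut (suc k)
    slotLength-+ k t = x-z+z≡x _ _

    slotLength-mono-≤ : ∀ k {s t} → s ≤ t → slotLength k s ≤ slotLength k t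
    slotLength-mono-≤ k {s} {t} s≤t with <-≤-total s (cut k)
    ... | inj₁ s<cut = subst (_≤ slotLength k t) (sym (slotLength-before (<⇒≤ s<cut)))
      (subst (_≤ slotLength k t) (x-x≡0 (t ⊓ cut k)) (+-monoˡ-≤ _ (⊓-monoʳ-≤ t (<⇒≤ (cut-mono k)))))
    ... | inj₂ cut≤s = subst (λ x → s ⊓ cut (suc k) - x ≤ slotLength k t)
      (trans (⊓-≥ (≤-trans cut≤s s≤t)) (sym (⊓-≥ cut≤s))) (+-monoˡ-≤ _ (⊓-monoˡ-≤ (cut (suc k)) s≤t))

    slotWork-own : ∀ q x → slotWork (just q) q x ≡ x
    slotWork-own q x with q Fin.≟ q
    ... | yes _ = refl
    ... | no ≢  = ⊥-elim (≢ refl)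

    slotWork-other : ∀ {r q} x → q ≢ r → slotWork (just r) q x ≡ 0#
    slotWork-other {r} {q} x q≢r with r Fin.≟ q
    ... | yes r≡q = ⊥-elim (q≢r (sym r≡q))
    ... | no  _   = refl

    slotWork-mono-≤ : ∀ d q {x y} → x ≤ y → slotWork d q x ≤ slotWork d q y
    slotWork-mono-≤ nothing  q x≤y = ≤-refl
    slotWork-mono-≤ (just r) q x≤y with r Fin.≟ q
    ... | yes _ = x≤y
    ... | no  _ = ≤-refl

    slotWork-+ : ∀ d q x y → slotWork d q (x + y) ≡ slotWork d q x + slotWork d q y
    slotWork-+ nothing  q x y = sym (𝔽.+-identityˡ 0#)
    slotWork-+ (just r) q x y with r Fin.≟ q
    ... | yes _ = refl
    ... | no  _ = sym (𝔽.+-identityˡ 0#)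

    slotWork-zero : ∀ d q {x} → (d ≡ just q → x ≡ 0#) → slotWork d q x ≡ 0#
    slotWork-zero nothing  q _ = refl
    slotWork-zero (just r) q h with r Fin.≟ q
    ... | yes refl = h refl
    ... | no  _    = refl

    workIn-extend : ∀ {k k′} q t → k ℕ.≤ k′ → t ≤ cut k → workIn k′ q t ≡ workIn k q t
    workIn-extend {zero}  {zero}  q t z≤n t≤ = refl
    workIn-extend {k} {suc k′} q t k≤ t≤ with ℕ.m≤n⇒m<n∨m≡n k≤
    ... | inj₂ refl        = refl
    ... | inj₁ (s≤s k≤k′) = trans
      (cong₂ _+_ (workIn-extend q t k≤k′ t≤)
                 (slotWork-zero (slot k′) q (λ _ → slotLength-before (≤-trans t≤ (cut-mono-≤ k≤k′)))))
      (𝔽.+-identityʳ _)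

    work≡workIn : ∀ k q t → t ≤ cut k → work S q t ≡ workIn k q t
    work≡workIn k q t t≤ with cut-unbounded t
    ... | k₀ , t<cut with ℕ.≤-total k₀ k
    ... | inj₁ k₀≤k = sym (workIn-extend q t k₀≤k (<⇒≤ t<cut))
    ... | inj₂ k≤k₀ = workIn-extend q t k≤k₀ t≤

    workIn-mono-≤ : ∀ k q {s t} → s ≤ t → workIn k q s ≤ workIn k q t
    workIn-mono-≤ zero    q s≤t = ≤-refl
    workIn-mono-≤ (suc k) q s≤t = +-mono-≤ (workIn-mono-≤ k q s≤t)
      (slotWork-mono-≤ (slot k) q (slotLength-mono-≤ k s≤t))

    work-mono-≤ : ∀ q {s t} → s ≤ t → work S q s ≤ work S q t
    work-mono-≤ q {s} {t} s≤t with cut-unbounded t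
    ... | k , t<cut = subst (_≤ workIn k q t) (sym (work≡workIn k q s (≤-trans s≤t (<⇒≤ t<cut))))
                        (workIn-mono-≤ k q s≤t)

    work-initial : ∀ q → work S q 0# ≡ 0#
    work-initial q = work≡workIn 0 q 0# (≤-reflexive (sym cut-zero))

    -- A single machine does at most t - s units of work between s and t.
    volume : ∀ (J : Subset m) {s t} → s ≤ t →
             sumOver J (λ q → work S q t) + s ≤ sumOver J (λ q → work S q s) + t
    volume J {s} {t} s≤t = subst₂ _≤_
      (cong₂ _+_ (sumOver-cong J (λ q → sym (work≡workIn k q t t≤))) (⊓-≤ s≤))
      (cong₂ _+_ (sumOver-cong J (λ q → sym (work≡workIn k q s s≤))) (⊓-≤ t≤))
      (upTo k)
      where
      k  = proj₁ (cut-unbounded t)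
      t≤ = <⇒≤ (proj₂ (cut-unbounded t))
      s≤ = ≤-trans s≤t t≤

      inSlot : ∀ d {x y} → x ≤ y →
               sumOver J (λ q → slotWork d q y) + x ≤ sumOver J (λ q → slotWork d q x) + y
      inSlot nothing  x≤y = +-monoʳ-≤ _ x≤y
      inSlot (just r) {x} {y} x≤y = sumOver-change J r
        (λ q q≢r → trans (slotWork-other y q≢r) (sym (slotWork-other x q≢r)))
        (≤-reflexive (trans (cong₂ _+_ (slotWork-own r y) refl)
          (trans (𝔽.+-comm y x) (cong₂ _+_ (sym (slotWork-own r x)) refl))))
        x≤y

      upTo : ∀ k → sumOver J (λ q → workIn k q t) + s ⊓ cut k ≤ sumOver J (λ q → workIn k q s) + t ⊓ cut k
      upTo zero    = +-monoʳ-≤ _ (⊓-monoˡ-≤ _ s≤t)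
      upTo (suc k) = subst₂ _≤_ (regroup t s) (regroup s t)
        (+-mono-≤ (upTo k) (inSlot (slot k) (slotLength-mono-≤ k s≤t)))
        where
        regroup : ∀ x y →
          sumOver J (λ q → workIn k q x) + y ⊓ cut k
            + (sumOver J (λ q → slotWork (slot k) q (slotLength k x)) + slotLength k y)
          ≡ sumOver J (λ q → workIn (suc k) q x) + y ⊓ cut (suc k)
        regroup x y = trans
          (solve 4 (λ a u b l → a :+ u :+ (b :+ l) := a :+ b :+ (l :+ u)) refl _ _ _ _)
          (cong₂ _+_ (sym (sumOver-+ J _ _)) (slotLength-+ k y))

    volume-single : ∀ q {s t} → s ≤ t → work S q t + s ≤ work S q s + t
    volume-single q {s} {t} s≤t = subst₂ (λ x y → x + s ≤ y + t) (sumOver-⁅⁆ q _) (sumOver-⁅⁆ q _) (volume ⁅ q ⁆ s≤t)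

    workIn-after : ∀ k q {s t} → cut k ≤ s → cut k ≤ t → workIn k q s ≡ workIn k q t
    workIn-after zero    q _ _ = refl
    workIn-after (suc k) q {s} {t} ≤s ≤t = cong₂ _+_
      (workIn-after k q (≤-trans (<⇒≤ (cut-mono k)) ≤s) (≤-trans (<⇒≤ (cut-mono k)) ≤t))
      (cong (slotWork (slot k) q) (trans (slotLength-after ≤s) (sym (slotLength-after ≤t))))

    -- Within a slot, the job of that slot is processed at unit rate.
    work-within : ∀ k q {s t} → cut k ≤ s → s ≤ t → t ≤ cut (suc k) →
                  work S q t ≡ work S q s + slotWork (slot k) q (t - s)
    work-within k q {s} {t} ≤s s≤t t≤ = begin
      work S q t
        ≡⟨ work≡workIn (suc k) q t t≤ ⟩
      workIn k q t + slotWork (slot k) q (slotLength k t)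
        ≡⟨ cong₂ _+_ (workIn-after k q (≤-trans ≤s s≤t) ≤s) (cong (slotWork (slot k) q) split) ⟩
      workIn k q s + slotWork (slot k) q (slotLength k s + (t - s))
        ≡⟨ cong (workIn k q s +_) (slotWork-+ (slot k) q _ _) ⟩
      workIn k q s + (slotWork (slot k) q (slotLength k s) + slotWork (slot k) q (t - s))
        ≡⟨ 𝔽.+-assoc _ _ _ ⟨
      workIn (suc k) q s + slotWork (slot k) q (t - s)
        ≡⟨ cong (_+ slotWork (slot k) q (t - s)) (work≡workIn (suc k) q s s≤) ⟨
      work S q s + slotWork (slot k) q (t - s) ∎
      where
      open ≡-Reasoning
      s≤ = ≤-trans s≤t t≤
      split : slotLength k t ≡ slotLength k s + (t - s)
      split = begin
        slotLength k t          ≡⟨ slotLength-within (≤-trans ≤s s≤t) t≤ ⟩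
        t - cut k               ≡⟨ cong (_- cut k) (x-z+z≡x t s) ⟨
        t - s + s - cut k       ≡⟨ solve 3 (λ d s c → d :+ s :+ c := s :+ c :+ d) refl _ _ _ ⟩
        s - cut k + (t - s)     ≡⟨ cong (_+ (t - s)) (slotLength-within ≤s s≤) ⟨
        slotLength k s + (t - s) ∎

  module _ {m : ℕ} (S S′ : Schedule m) where
    private
      module S  = Schedule S
      module S′ = Schedule S′

    -- Two schedules that make the same decisions before T do the same work before
    -- T, although their cuts may differ: walk through the common refinement of the
    -- two partitions, by induction on the numbers of cuts up to t.
    work-agree : ∀ {T} → (∀ t → 0# ≤ t → t < T → ∀ d → Runs S t d → Runs S′ t d) →
                 ∀ q t → t ≤ T → work S q t ≡ work S′ q t
    work-agree {T} same q t t≤T =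
      go _ _ t t≤T (<⇒≤ (proj₂ (S.cut-unbounded t))) (<⇒≤ (proj₂ (S′.cut-unbounded t)))
      where
      open ≡-Reasoning

      go : ∀ k k′ t → t ≤ T → t ≤ S.cut k → t ≤ S′.cut k′ → work S q t ≡ work S′ q t

      step : ∀ k k′ s t → t ≤ T → s < t →
             S.cut k ≤ s → t ≤ S.cut (suc k) → S′.cut k′ ≤ s → t ≤ S′.cut (suc k′) →
             work S q s ≡ work S′ q s → work S q t ≡ work S′ q t
      step k k′ s t t≤T s<t k≤s t≤k k′≤s t≤k′ eq = begin
        work S q t                                      ≡⟨ work-within S k q k≤s (<⇒≤ s<t) t≤k ⟩
        work S q s + S.slotWork (S.slot k) q (t - s)    ≡⟨ cong₂ _+_ eq (slotWork-≡ (S.slot k) _) ⟩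
        work S′ q s + S′.slotWork (S.slot k) q (t - s)  ≡⟨ cong (λ d → work S′ q s + S′.slotWork d q (t - s)) slot≡ ⟩
        work S′ q s + S′.slotWork (S′.slot k′) q (t - s) ≡⟨ work-within S′ k′ q k′≤s (<⇒≤ s<t) t≤k′ ⟨
        work S′ q t                                     ∎
        where
        slotWork-≡ : ∀ d x → S.slotWork d q x ≡ S′.slotWork d q x
        slotWork-≡ nothing  x = refl
        slotWork-≡ (just r) x with r Fin.≟ q
        ... | yes _ = refl
        ... | no  _ = refl
        0≤s : 0# ≤ s
        0≤s = ≤-trans (subst (_≤ S.cut k) S.cut-zero (cut-mono-≤ S z≤n)) k≤s
        slot≡ : S.slot k ≡ S′.slot k′
        slot≡ = Runs-unique S′
          (same s 0≤s (<-≤-trans s<t t≤T) _ (Runs-slot S k≤s (<-≤-trans s<t t≤k)))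
          (Runs-slot S′ k′≤s (<-≤-trans s<t t≤k′))

      go zero k′ t _ t≤k t≤k′ = trans (work≡workIn S 0 q t t≤k)
        (sym (work≡workIn S′ 0 q t (≤-trans t≤k (≤-reflexive (trans S.cut-zero (sym S′.cut-zero))))))
      go (suc k) zero t _ t≤k t≤k′ = trans
        (work≡workIn S 0 q t (≤-trans t≤k′ (≤-reflexive (trans S′.cut-zero (sym S.cut-zero)))))
        (sym (work≡workIn S′ 0 q t t≤k′))
      go (suc k) (suc k′) t t≤T t≤k t≤k′ with <-≤-total (S.cut k) t | <-≤-total (S′.cut k′) t
      ... | inj₂ t≤cut | _ = go k (suc k′) t t≤T t≤cut t≤k′
      ... | inj₁ _ | inj₂ t≤cut′ = go (suc k) k′ t t≤T t≤k t≤cut′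
      ... | inj₁ cut<t | inj₁ cut′<t with <-≤-total (S.cut k) (S′.cut k′)
      ... | inj₁ cut<cut′ = step k k′ (S′.cut k′) t t≤T cut′<t (<⇒≤ cut<cut′) t≤k ≤-refl t≤k′
              (go (suc k) k′ (S′.cut k′) (≤-trans (<⇒≤ cut′<t) t≤T) (≤-trans (<⇒≤ cut′<t) t≤k) ≤-refl)
      ... | inj₂ cut′≤cut = step k k′ (S.cut k) t t≤T cut<t ≤-refl t≤k cut′≤cut t≤k′
              (go k (suc k′) (S.cut k) (≤-trans (<⇒≤ cut<t) t≤T) ≤-refl (≤-trans (<⇒≤ cut<t) t≤k′))

    decisions⇒runs : ∀ {t} → Decision S t ≐ Decision S′ t → ∀ d → Runs S t d → Runs S′ t d
    decisions⇒runs (⊆ , _) d runs with ⊆ (d , runs , refl)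
    ... | d′ , runs′ , eq = subst (Runs S′ _) (Maybe.map-injective Fin.toℕ-injective eq) runs′

  module _ (Q : Input) (S : Schedule (Input.size Q)) (valid : Valid Q S) where
    open Schedule S hiding (Runs; work)

    work-unreleased : ∀ q {t} → t ≤ release (job Q q) → work S q t ≡ 0#
    work-unreleased q {t} t≤r with cut-unbounded t
    ... | k , _ = upTo k
      where
      upTo : ∀ k → workIn k q t ≡ 0#
      upTo zero    = refl
      upTo (suc k) = trans (cong₂ _+_ (upTo k) (slotWork-zero S (slot k) q λ eq →
        slotLength-before S (≤-trans t≤r (proj₁ (valid (cut k) q (k , ≤-refl , cut-mono k , eq))))))
        (𝔽.+-identityʳ 0#)

    processing≤work : ∀ {q c t} → CompletesAt Q S q c → c ≤ t → processing (job Q q) ≤ work S q t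
    processing≤work {q} {t = t} (eq , _) c≤t = subst (_≤ work S q t) eq (work-mono-≤ S q c≤t)

    completes-after : ∀ {q c t} → CompletesAt Q S q c → work S q t < processing (job Q q) → t < c
    completes-after {q} {c} {t} done w<p with <-≤-total t c
    ... | inj₁ t<c = t<c
    ... | inj₂ c≤t = ⊥-elim (≤⇒≯ (processing≤work done c≤t) w<p)

-- Scales of the instance

module Scales (K : ℕ) (2≤K : 2 ℕ.≤ K) where
  open import Data.Nat.Base using (_+_; _*_; _^_; _≤_; _<_)

  -- K is chosen such that B / K bounds the distortion of the predictions.
  B : ℕ
  B = suc K

  -- The pair of level ℓ consists of a job of length short ℓ and one of length
  -- long ℓ = unit ℓ + short ℓ.
  unit short long : ℕ → ℕ
  unit  ℓ = B ^ ℓ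
  short ℓ = K * unit ℓ
  long  ℓ = B * unit ℓ

  unit-pos : ∀ ℓ → 0 < unit ℓ
  unit-pos ℓ = ℕ.m^n>0 B ℓ

  2unit≤short : ∀ ℓ → unit ℓ + unit ℓ ≤ short ℓ
  2unit≤short ℓ = subst (_≤ short ℓ) (cong (unit ℓ +_) (ℕ.+-identityʳ _)) (ℕ.*-monoˡ-≤ (unit ℓ) 2≤K)

  short-pos : ∀ ℓ → 0 < short ℓ
  short-pos ℓ = ℕ.≤-trans (unit-pos ℓ) (ℕ.≤-trans (ℕ.m≤m+n _ _) (2unit≤short ℓ))

  long-pos : ∀ ℓ → 0 < long ℓ
  long-pos ℓ = unit-pos (suc ℓ)

  short≤long : ∀ ℓ → short ℓ ≤ long ℓ
  short≤long ℓ = ℕ.m≤n+m (short ℓ) (unit ℓ)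

  -- The total processing time of the pairs of levels below ℓ.
  pairWork : ℕ → ℕ
  pairWork zero    = 0
  pairWork (suc ℓ) = short ℓ + pairWork ℓ + long ℓ

  -- The part of the offline flow time that does not depend on the length of the
  -- stream.
  overhead : ℕ → ℕ
  overhead zero    = 0
  overhead (suc ℓ) = short ℓ + pairWork (suc ℓ) + overhead ℓ

-- The instance and its offline schedule, in natural numbers

module Instance (K n : ℕ) (2≤K : 2 ℕ.≤ K) where
  open import Data.Nat.Base using (_+_; _*_; _^_; _≤_; _<_)
  open Scales K 2≤K public

  -- The number of jobs of the instance with the pairs of levels below ℓ and a
  -- stream of n unit jobs.  Indices 0 and 1 denote the jobs of the pair of the
  -- highest level, which is released first; the others denote the jobs of the
  -- instance with one level less.
  #jobs : ℕ → ℕ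
  #jobs zero    = n
  #jobs (suc ℓ) = suc (suc (#jobs ℓ))

  n≤#jobs : ∀ ℓ → n ≤ #jobs ℓ
  n≤#jobs zero    = ℕ.≤-refl
  n≤#jobs (suc ℓ) = ℕ.m≤n⇒m≤1+n (ℕ.m≤n⇒m≤1+n (n≤#jobs ℓ))

  -- The choices of the adversary, highest level first: false makes the job of
  -- index 0 of a pair the short one, true the job of index 1.
  Bits : ℕ → Set
  Bits = Vec Bool

  -- The processing times.
  proc : ∀ ℓ → Bits ℓ → Fin (#jobs ℓ) → ℕ
  proc zero    []          _             = 1
  proc (suc ℓ) (b     ∷ β) (suc (suc q)) = proc ℓ β q
  proc (suc ℓ) (false ∷ β) zero          = short ℓ
  proc (suc ℓ) (true  ∷ β) zero          = long ℓ
  proc (suc ℓ) (false ∷ β) (suc zero)    = long ℓ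
  proc (suc ℓ) (true  ∷ β) (suc zero)    = short ℓ

  -- The predicted processing times, which do not depend on the choices.
  pred : ∀ ℓ → Fin (#jobs ℓ) → ℕ
  pred zero    _             = 1
  pred (suc ℓ) zero          = short ℓ
  pred (suc ℓ) (suc zero)    = short ℓ
  pred (suc ℓ) (suc (suc q)) = pred ℓ q

  -- The release times when the highest level is released at r.
  rel : ∀ ℓ → ℕ → Fin (#jobs ℓ) → ℕ
  rel zero    r q             = r + toℕ q
  rel (suc ℓ) r zero          = r
  rel (suc ℓ) r (suc zero)    = r
  rel (suc ℓ) r (suc (suc q)) = rel ℓ (r + short ℓ) q

  -- The release time of the first job of the stream.
  streamStart : ℕ → ℕ → ℕ
  streamStart zero    r = r
  streamStart (suc ℓ) r = streamStart ℓ (r + short ℓ)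

  pred-pos : ∀ ℓ q → 0 < pred ℓ q
  pred-pos zero    _             = s≤s z≤n
  pred-pos (suc ℓ) zero          = short-pos ℓ
  pred-pos (suc ℓ) (suc zero)    = short-pos ℓ
  pred-pos (suc ℓ) (suc (suc q)) = pred-pos ℓ q

  pred≤proc : ∀ ℓ β q → pred ℓ q ≤ proc ℓ β q
  pred≤proc zero    []          _             = ℕ.≤-refl
  pred≤proc (suc ℓ) (false ∷ β) zero          = ℕ.≤-refl
  pred≤proc (suc ℓ) (true  ∷ β) zero          = short≤long ℓ
  pred≤proc (suc ℓ) (false ∷ β) (suc zero)    = short≤long ℓ
  pred≤proc (suc ℓ) (true  ∷ β) (suc zero)    = ℕ.≤-refl
  pred≤proc (suc ℓ) (b     ∷ β) (suc (suc q)) = pred≤proc ℓ β q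

  proc-pos : ∀ ℓ β q → 0 < proc ℓ β q
  proc-pos ℓ β q = ℕ.≤-trans (pred-pos ℓ q) (pred≤proc ℓ β q)

  -- Cross-multiplied, so that it reads proc ≤ (B / K) · pred.
  K*proc≤B*pred : ∀ ℓ β q → K * proc ℓ β q ≤ B * pred ℓ q
  K*proc≤B*pred zero    []          _             = ℕ.*-monoˡ-≤ 1 (ℕ.n≤1+n K)
  K*proc≤B*pred (suc ℓ) (false ∷ β) zero          = ℕ.*-monoˡ-≤ (short ℓ) (ℕ.n≤1+n K)
  K*proc≤B*pred (suc ℓ) (true  ∷ β) zero          = ℕ.≤-reflexive
    (solveℕ 3 (λ k b u → k ⊗ (b ⊗ u) ⊜ b ⊗ (k ⊗ u)) refl K B (unit ℓ))
  K*proc≤B*pred (suc ℓ) (false ∷ β) (suc zero)    = K*proc≤B*pred (suc ℓ) (true ∷ β) zero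
  K*proc≤B*pred (suc ℓ) (true  ∷ β) (suc zero)    = K*proc≤B*pred (suc ℓ) (false ∷ β) zero
  K*proc≤B*pred (suc ℓ) (b     ∷ β) (suc (suc q)) = K*proc≤B*pred ℓ β q

  r≤rel : ∀ ℓ r q → r ≤ rel ℓ r q
  r≤rel zero    r q             = ℕ.m≤m+n r _
  r≤rel (suc ℓ) r zero          = ℕ.≤-refl
  r≤rel (suc ℓ) r (suc zero)    = ℕ.≤-refl
  r≤rel (suc ℓ) r (suc (suc q)) = ℕ.≤-trans (ℕ.m≤m+n r _) (r≤rel ℓ _ q)

  r≤streamStart : ∀ ℓ r → r ≤ streamStart ℓ r
  r≤streamStart zero    r = ℕ.≤-refl
  r≤streamStart (suc ℓ) r = ℕ.≤-trans (ℕ.m≤m+n r _) (r≤streamStart ℓ _)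

  -- The offline schedule, for an instance that starts at time 0: slot ℓ β j is the
  -- job of the j-th slot, which has length dur ℓ j and starts at C ℓ j.  The
  -- schedule of level ℓ is preceded by the short job of the next pair, and the long
  -- job of that pair takes the first idle slot.  All later slots remain idle; their
  -- positive length lets the cuts grow without bound.
  dur : ℕ → ℕ → ℕ
  dur zero    j       = 1
  dur (suc ℓ) zero    = short ℓ
  dur (suc ℓ) (suc j) with j ℕ.≟ #jobs ℓ
  ... | yes _ = long ℓ
  ... | no  _ = dur ℓ j

  C : ℕ → ℕ → ℕ
  C ℓ zero    = 0
  C ℓ (suc j) = C ℓ j + dur ℓ j

  slot : ∀ ℓ → Bits ℓ → ℕ → Maybe (Fin (#jobs ℓ))
  slot zero    []      j with j ℕ.<? n
  ... | yes j<n = just (fromℕ< j<n)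
  ... | no  _   = nothing
  slot (suc ℓ) (b ∷ β) (suc j) with j ℕ.≟ #jobs ℓ | b
  ... | yes _ | false = just (suc zero)
  ... | yes _ | true  = just zero
  ... | no  _ | _     = Maybe.map (λ q → suc (suc q)) (slot ℓ β j)
  slot (suc ℓ) (false ∷ β) zero = just zero
  slot (suc ℓ) (true  ∷ β) zero = just (suc zero)

  -- The slot in which the offline schedule runs a job, inverse to slot.
  pos : ∀ ℓ → Bits ℓ → Fin (#jobs ℓ) → ℕ
  pos zero    []          q             = toℕ q
  pos (suc ℓ) (b     ∷ β) (suc (suc q)) = suc (pos ℓ β q)
  pos (suc ℓ) (false ∷ β) zero          = zero
  pos (suc ℓ) (true  ∷ β) zero          = suc (#jobs ℓ)
  pos (suc ℓ) (false ∷ β) (suc zero)    = suc (#jobs ℓ)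
  pos (suc ℓ) (true  ∷ β) (suc zero)    = zero

  pos<#jobs : ∀ ℓ β q → pos ℓ β q < #jobs ℓ
  pos<#jobs zero    []          q             = Fin.toℕ<n q
  pos<#jobs (suc ℓ) (false ∷ β) zero          = s≤s z≤n
  pos<#jobs (suc ℓ) (true  ∷ β) zero          = ℕ.≤-refl
  pos<#jobs (suc ℓ) (false ∷ β) (suc zero)    = ℕ.≤-refl
  pos<#jobs (suc ℓ) (true  ∷ β) (suc zero)    = s≤s z≤n
  pos<#jobs (suc ℓ) (b     ∷ β) (suc (suc q)) = s≤s (ℕ.m≤n⇒m≤1+n (pos<#jobs ℓ β q))

  slot-pos : ∀ ℓ β q → slot ℓ β (pos ℓ β q) ≡ just q
  slot-pos zero [] q with toℕ q ℕ.<? n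
  ... | yes p = cong just (Fin.fromℕ<-toℕ q p)
  ... | no ≮  = ⊥-elim (≮ (Fin.toℕ<n q))
  slot-pos (suc ℓ) (false ∷ β) zero = refl
  slot-pos (suc ℓ) (true  ∷ β) zero with #jobs ℓ ℕ.≟ #jobs ℓ
  ... | yes _ = refl
  ... | no ≢  = ⊥-elim (≢ refl)
  slot-pos (suc ℓ) (false ∷ β) (suc zero) with #jobs ℓ ℕ.≟ #jobs ℓ
  ... | yes _ = refl
  ... | no ≢  = ⊥-elim (≢ refl)
  slot-pos (suc ℓ) (true  ∷ β) (suc zero) = refl
  slot-pos (suc ℓ) (b     ∷ β) (suc (suc q)) with pos ℓ β q ℕ.≟ #jobs ℓ
  ... | yes eq = ⊥-elim (ℕ.<⇒≢ (pos<#jobs ℓ β q) eq)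
  ... | no  _  = cong (Maybe.map (λ q → suc (suc q))) (slot-pos ℓ β q)

  pos-slot : ∀ ℓ β j q → slot ℓ β j ≡ just q → j ≡ pos ℓ β q
  pos-slot zero [] j q eq with j ℕ.<? n
  pos-slot zero [] j q refl | yes j<n = sym (Fin.toℕ-fromℕ< j<n)
  pos-slot (suc ℓ) (false ∷ β) zero q refl = refl
  pos-slot (suc ℓ) (true  ∷ β) zero q refl = refl
  pos-slot (suc ℓ) (b ∷ β) (suc j) q eq with j ℕ.≟ #jobs ℓ | b
  pos-slot (suc ℓ) (b ∷ β) (suc j) q refl | yes j≡ | false = cong suc j≡
  pos-slot (suc ℓ) (b ∷ β) (suc j) q refl | yes j≡ | true  = cong suc j≡
  ... | no _ | _ with slot ℓ β j in eq′
  pos-slot (suc ℓ) (b ∷ β) (suc j) q refl | no _ | _ | just q′ = cong suc (pos-slot ℓ β j q′ eq′)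

  dur-pos : ∀ ℓ j → 0 < dur ℓ j
  dur-pos zero    j    = s≤s z≤n
  dur-pos (suc ℓ) zero = short-pos ℓ
  dur-pos (suc ℓ) (suc j) with j ℕ.≟ #jobs ℓ
  ... | yes _ = long-pos ℓ
  ... | no  _ = dur-pos ℓ j

  dur-#jobs : ∀ ℓ → dur (suc ℓ) (suc (#jobs ℓ)) ≡ long ℓ
  dur-#jobs ℓ with #jobs ℓ ℕ.≟ #jobs ℓ
  ... | yes _ = refl
  ... | no ≢  = ⊥-elim (≢ refl)

  dur-< : ∀ ℓ {j} → j < #jobs ℓ → dur (suc ℓ) (suc j) ≡ dur ℓ j
  dur-< ℓ {j} j< with j ℕ.≟ #jobs ℓ
  ... | yes eq = ⊥-elim (ℕ.<⇒≢ j< eq)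
  ... | no  _  = refl

  proc≡dur : ∀ ℓ β q → proc ℓ β q ≡ dur ℓ (pos ℓ β q)
  proc≡dur zero    []          q             = refl
  proc≡dur (suc ℓ) (false ∷ β) zero          = refl
  proc≡dur (suc ℓ) (true  ∷ β) zero          = sym (dur-#jobs ℓ)
  proc≡dur (suc ℓ) (false ∷ β) (suc zero)    = sym (dur-#jobs ℓ)
  proc≡dur (suc ℓ) (true  ∷ β) (suc zero)    = refl
  proc≡dur (suc ℓ) (b     ∷ β) (suc (suc q)) =
    trans (proc≡dur ℓ β q) (sym (dur-< ℓ (pos<#jobs ℓ β q)))

  C-< : ∀ ℓ j → C ℓ j < C ℓ (suc j)
  C-< ℓ j = ℕ.m<m+n (C ℓ j) (dur-pos ℓ j)

  j≤C : ∀ ℓ j → j ≤ C ℓ j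
  j≤C ℓ zero    = z≤n
  j≤C ℓ (suc j) = ℕ.≤-<-trans (j≤C ℓ j) (C-< ℓ j)

  C-zero : ∀ j → C zero j ≡ j
  C-zero zero    = refl
  C-zero (suc j) = trans (ℕ.+-comm (C zero j) 1) (cong suc (C-zero j))

  C-shift : ∀ ℓ m → m ≤ #jobs ℓ → C (suc ℓ) (suc m) ≡ short ℓ + C ℓ m
  C-shift ℓ zero    _  = sym (ℕ.+-identityʳ (short ℓ))
  C-shift ℓ (suc m) m< = begin
    C (suc ℓ) (suc m) + dur (suc ℓ) (suc m)  ≡⟨ cong₂ _+_ (C-shift ℓ m (ℕ.<⇒≤ m<)) (dur-< ℓ m<) ⟩
    short ℓ + C ℓ m + dur ℓ m                ≡⟨ ℕ.+-assoc (short ℓ) _ _ ⟩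
    short ℓ + (C ℓ m + dur ℓ m)              ∎
    where open ≡-Reasoning

  C-last : ∀ ℓ → C (suc ℓ) (#jobs (suc ℓ)) ≡ short ℓ + C ℓ (#jobs ℓ) + long ℓ
  C-last ℓ = cong₂ _+_ (C-shift ℓ (#jobs ℓ) ℕ.≤-refl) (dur-#jobs ℓ)

  mutual
    -- The first m + 1 slots last at most long ℓ + m, because the long job of level ℓ
    -- outweighs all pairs of the levels below.
    C-suc-≤ : ∀ ℓ m → m < #jobs ℓ → C ℓ (suc m) ≤ long ℓ + m
    C-suc-≤ zero    m       _         = subst (_≤ long zero + m) (sym (C-zero (suc m)))
                                          (ℕ.+-monoˡ-≤ m (long-pos zero))
    C-suc-≤ (suc ℓ) zero    _         = begin
      short ℓ           ≤⟨ short≤long ℓ ⟩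
      long ℓ            ≤⟨ ℕ.m≤n*m (long ℓ) B ⟩
      long (suc ℓ)      ≡⟨ ℕ.+-identityʳ _ ⟨
      long (suc ℓ) + 0  ∎
      where open ℕ.≤-Reasoning
    C-suc-≤ (suc ℓ) (suc m) (s≤s m<) with ℕ.m≤n⇒m<n∨m≡n m<
    ... | inj₁ (s≤s m<′) = begin
      C (suc ℓ) (suc (suc m))        ≡⟨ C-shift ℓ (suc m) m<′ ⟩
      short ℓ + C ℓ (suc m)          ≤⟨ ℕ.+-monoʳ-≤ (short ℓ) (C-suc-≤ ℓ m m<′) ⟩
      short ℓ + (long ℓ + m)         ≡⟨ ℕ.+-assoc (short ℓ) _ _ ⟨
      short ℓ + long ℓ + m           ≤⟨ ℕ.+-mono-≤ (ℕ.m≤m+n _ (long ℓ)) (ℕ.n≤1+n m) ⟩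
      short ℓ + long ℓ + long ℓ + suc m  ≤⟨ ℕ.+-monoˡ-≤ (suc m) (short+2long≤ ℓ) ⟩
      long (suc ℓ) + suc m           ∎
      where open ℕ.≤-Reasoning
    ... | inj₂ refl = begin
      C (suc ℓ) (#jobs (suc ℓ))             ≡⟨ C-last ℓ ⟩
      short ℓ + C ℓ (#jobs ℓ) + long ℓ      ≤⟨ ℕ.+-monoˡ-≤ (long ℓ) (ℕ.+-monoʳ-≤ (short ℓ) (C-#jobs-≤ ℓ)) ⟩
      short ℓ + (long ℓ + #jobs ℓ) + long ℓ
        ≡⟨ solveℕ 3 (λ s l z → s ⊕ (l ⊕ z) ⊕ l ⊜ s ⊕ l ⊕ l ⊕ z) refl (short ℓ) (long ℓ) (#jobs ℓ) ⟩
      short ℓ + long ℓ + long ℓ + #jobs ℓ   ≤⟨ ℕ.+-mono-≤ (short+2long≤ ℓ) (ℕ.n≤1+n (#jobs ℓ)) ⟩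
      long (suc ℓ) + suc (#jobs ℓ)          ∎
      where open ℕ.≤-Reasoning

    C-#jobs-≤ : ∀ ℓ → C ℓ (#jobs ℓ) ≤ long ℓ + #jobs ℓ
    C-#jobs-≤ ℓ with #jobs ℓ in eq
    ... | zero  = z≤n
    ... | suc m = ℕ.≤-trans (C-suc-≤ ℓ m (ℕ.≤-reflexive (sym eq))) (ℕ.+-monoʳ-≤ (long ℓ) (ℕ.n≤1+n m))

    short+2long≤ : ∀ ℓ → short ℓ + long ℓ + long ℓ ≤ long (suc ℓ)
    short+2long≤ ℓ = begin
      short ℓ + long ℓ + long ℓ ≤⟨ ℕ.+-monoˡ-≤ (long ℓ) (ℕ.+-monoˡ-≤ (long ℓ) (short≤long ℓ)) ⟩
      long ℓ + long ℓ + long ℓ  ≡⟨ solveℕ 1 (λ l → l ⊕ l ⊕ l ⊜ κ 3 ⊗ l) refl (long ℓ) ⟩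
      3 * long ℓ                ≤⟨ ℕ.*-monoˡ-≤ (long ℓ) (s≤s 2≤K) ⟩
      long (suc ℓ)              ∎
      where open ℕ.≤-Reasoning

  C-suc-suc-≤ : ∀ ℓ m → m < #jobs ℓ → C (suc ℓ) (suc (suc m)) ≤ short ℓ + long ℓ + m
  C-suc-suc-≤ ℓ m m< = begin
    C (suc ℓ) (suc (suc m))  ≡⟨ C-shift ℓ (suc m) m< ⟩
    short ℓ + C ℓ (suc m)    ≤⟨ ℕ.+-monoʳ-≤ (short ℓ) (C-suc-≤ ℓ m m<) ⟩
    short ℓ + (long ℓ + m)   ≡⟨ ℕ.+-assoc (short ℓ) _ _ ⟨
    short ℓ + long ℓ + m     ∎
    where open ℕ.≤-Reasoning

  -- No job is run before its release.
  rel≤start : ∀ ℓ r β q → rel ℓ r q ≤ r + C ℓ (pos ℓ β q)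
  rel≤start zero    r []          q             = ℕ.+-monoʳ-≤ r (j≤C zero (toℕ q))
  rel≤start (suc ℓ) r (false ∷ β) zero          = ℕ.m≤m+n r _
  rel≤start (suc ℓ) r (true  ∷ β) zero          = ℕ.m≤m+n r _
  rel≤start (suc ℓ) r (false ∷ β) (suc zero)    = ℕ.m≤m+n r _
  rel≤start (suc ℓ) r (true  ∷ β) (suc zero)    = ℕ.m≤m+n r _
  rel≤start (suc ℓ) r (b     ∷ β) (suc (suc q)) = begin
    rel ℓ (r + short ℓ) q              ≤⟨ rel≤start ℓ _ β q ⟩
    r + short ℓ + C ℓ (pos ℓ β q)      ≡⟨ ℕ.+-assoc r _ _ ⟩
    r + (short ℓ + C ℓ (pos ℓ β q))    ≡⟨ cong (r +_) (C-shift ℓ _ (ℕ.<⇒≤ (pos<#jobs ℓ β q))) ⟨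
    r + C (suc ℓ) (suc (pos ℓ β q))    ∎
    where open ℕ.≤-Reasoning

  -- The flow times in the offline schedule.
  flow : ∀ ℓ → Bits ℓ → Fin (#jobs ℓ) → ℕ
  flow zero    []          q             = 1
  flow (suc ℓ) (b     ∷ β) (suc (suc q)) = flow ℓ β q
  flow (suc ℓ) (false ∷ β) zero          = short ℓ
  flow (suc ℓ) (true  ∷ β) zero          = short ℓ + C ℓ (#jobs ℓ) + long ℓ
  flow (suc ℓ) (false ∷ β) (suc zero)    = short ℓ + C ℓ (#jobs ℓ) + long ℓ
  flow (suc ℓ) (true  ∷ β) (suc zero)    = short ℓ

  completion : ∀ ℓ r β q → r + C ℓ (suc (pos ℓ β q)) ≡ rel ℓ r q + flow ℓ β q
  completion zero    r []          q             = begin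
    r + C zero (suc (toℕ q))  ≡⟨ cong (r +_) (C-zero (suc (toℕ q))) ⟩
    r + suc (toℕ q)           ≡⟨ solveℕ 2 (λ r q → r ⊕ (κ 1 ⊕ q) ⊜ r ⊕ q ⊕ κ 1) refl r (toℕ q) ⟩
    r + toℕ q + 1             ∎
    where open ≡-Reasoning
  completion (suc ℓ) r (false ∷ β) zero          = refl
  completion (suc ℓ) r (true  ∷ β) zero          = cong (r +_) (C-last ℓ)
  completion (suc ℓ) r (false ∷ β) (suc zero)    = cong (r +_) (C-last ℓ)
  completion (suc ℓ) r (true  ∷ β) (suc zero)    = refl
  completion (suc ℓ) r (b     ∷ β) (suc (suc q)) = begin
    r + C (suc ℓ) (suc (suc (pos ℓ β q)))  ≡⟨ cong (r +_) (C-shift ℓ _ (pos<#jobs ℓ β q)) ⟩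
    r + (short ℓ + C ℓ (suc (pos ℓ β q)))  ≡⟨ ℕ.+-assoc r _ _ ⟨
    r + short ℓ + C ℓ (suc (pos ℓ β q))    ≡⟨ completion ℓ (r + short ℓ) β q ⟩
    rel ℓ (r + short ℓ) q + flow ℓ β q     ∎
    where open ≡-Reasoning

  C-#jobs : ∀ ℓ → C ℓ (#jobs ℓ) ≡ n + pairWork ℓ
  C-#jobs zero    = trans (C-zero n) (sym (ℕ.+-identityʳ n))
  C-#jobs (suc ℓ) = begin
    C (suc ℓ) (#jobs (suc ℓ))             ≡⟨ C-last ℓ ⟩
    short ℓ + C ℓ (#jobs ℓ) + long ℓ      ≡⟨ cong (λ x → short ℓ + x + long ℓ) (C-#jobs ℓ) ⟩
    short ℓ + (n + pairWork ℓ) + long ℓ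
      ≡⟨ solveℕ 4 (λ s n w l → s ⊕ (n ⊕ w) ⊕ l ⊜ n ⊕ (s ⊕ w ⊕ l)) refl
                  (short ℓ) n (pairWork ℓ) (long ℓ) ⟩
    n + (short ℓ + pairWork ℓ + long ℓ)  ∎
    where open ≡-Reasoning

  -- Lower bounds on the online flow times, when the j-th completion happens no
  -- earlier than e + j after the start of the stream and jobs complete in the order
  -- given by pos.  The order is immaterial for the sum; e counts the higher levels.
  delay : ∀ ℓ → ℕ → Bits ℓ → Fin (#jobs ℓ) → ℕ
  delay zero    e []          q             = suc e
  delay (suc ℓ) e (b     ∷ β) (suc (suc q)) = delay ℓ (suc e) β q
  delay (suc ℓ) e (false ∷ β) zero          = 0
  delay (suc ℓ) e (true  ∷ β) zero          = n
  delay (suc ℓ) e (false ∷ β) (suc zero)    = n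
  delay (suc ℓ) e (true  ∷ β) (suc zero)    = 0

  delay-≤ : ∀ ℓ r e β q → rel ℓ r q + delay ℓ e β q ≤ streamStart ℓ r + (e + suc (pos ℓ β q))
  delay-≤ zero    r e [] q = ℕ.≤-reflexive
    (solveℕ 3 (λ r e q → r ⊕ q ⊕ (κ 1 ⊕ e) ⊜ r ⊕ (e ⊕ (κ 1 ⊕ q))) refl r e (toℕ q))
  delay-≤ (suc ℓ) r e (false ∷ β) zero = ℕ.+-mono-≤ (r≤streamStart (suc ℓ) r) z≤n
  delay-≤ (suc ℓ) r e (true  ∷ β) zero = ℕ.+-mono-≤ (r≤streamStart (suc ℓ) r)
    (ℕ.≤-trans (n≤#jobs (suc ℓ)) (ℕ.m≤n+m _ e))
  delay-≤ (suc ℓ) r e (false ∷ β) (suc zero) = delay-≤ (suc ℓ) r e (true ∷ β) zero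
  delay-≤ (suc ℓ) r e (true  ∷ β) (suc zero) = delay-≤ (suc ℓ) r e (false ∷ β) zero
  delay-≤ (suc ℓ) r e (b ∷ β) (suc (suc q)) = subst
    (λ x → rel ℓ (r + short ℓ) q + delay ℓ (suc e) β q ≤ streamStart ℓ (r + short ℓ) + x)
    (sym (ℕ.+-suc e _)) (delay-≤ ℓ (r + short ℓ) (suc e) β q)

-- The adversary

module Adversary (R : RealField) where
  open RealField R
  open OrderedField R
  open FiniteSums R
  open SPPT R
  open ScheduleProperties R
  open Solver using (solve; _:+_; _:*_; _:=_; con)

  input : ∀ {N} → (Fin N → Job) → Input
  input {N} F = record { size = N ; job = F }

  -- When S is the run on Q, no completion is revealed before T.
  NoCompletionBefore : (Q : Input) → Schedule (Input.size Q) → ℝ → Set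
  NoCompletionBefore Q S T = ∀ q t → t < T → work S q t < processing (job Q q)

  module _ (ALG : OnlineAlgorithm) where

    -- Before any completion only releases and predictions are revealed, so runs on
    -- inputs that share these do the same work.
    indistinguishable : ∀ {N} (F F′ : Fin N → Job) T →
      (∀ q → release (F q) ≡ release (F′ q) × predicted (F q) ≡ predicted (F′ q)) →
      NoCompletionBefore (input F)  (run ALG (input F))  T →
      NoCompletionBefore (input F′) (run ALG (input F′)) T →
      ∀ q → work (run ALG (input F)) q T ≡ work (run ALG (input F′)) q T
    indistinguishable F F′ T same none none′ q = work-agree S S′
      (λ t _ t<T → decisions⇒runs S S′ (OnlineAlgorithm.online ALG (input F) (input F′) t
        ( revealed F F′ same none t<T
        , revealed F′ F (λ q → sym (proj₁ (same q)) , sym (proj₂ (same q))) none′ t<T)))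
      q T ≤-refl
      where
      S  = run ALG (input F)
      S′ = run ALG (input F′)
      revealed : ∀ F F′ → (∀ q → release (F q) ≡ release (F′ q) × predicted (F q) ≡ predicted (F′ q)) →
        NoCompletionBefore (input F) (run ALG (input F)) T → ∀ {t} → t < T →
        Revealed (input F) (run ALG (input F)) t ⊆ Revealed (input F′) (run ALG (input F′)) t
      revealed F F′ same none t<T {released i r p̃} (r≤t , q , name , r≡ , p̃≡) =
        r≤t , q , name , trans (sym (proj₁ (same q))) r≡ , trans (sym (proj₂ (same q))) p̃≡
      revealed F F′ same none t<T {completed i c} (c≤t , q , name , work≡p , _) =
        ⊥-elim (<-irrefl (subst (_< processing (F q)) work≡p (none q c (≤-<-trans c≤t t<T))))

  halve-≤ : ∀ {x y} → x + x ≤ y + y → x ≤ y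
  halve-≤ {x} {y} 2x≤2y with <-≤-total y x
  ... | inj₁ y<x = ⊥-elim (≤⇒≯ 2x≤2y (+-mono-<-≤ y<x (<⇒≤ y<x)))
  ... | inj₂ x≤y = x≤y

  module _ (K n : ℕ) (2≤K : 2 ℕ.≤ K) (ALG : OnlineAlgorithm) {N : ℕ} where
    open Instance K n 2≤K

    runOn : (Fin N → Job) → Schedule N
    runOn F = run ALG (input F)

    -- At time r, the algorithm still has to spend at least u on q.
    Residual : (Fin N → Job) → ℕ → ℕ → Fin N → Set
    Residual F r u q = work (runOn F) q (ι r) + ι u ≤ processing (F q)

    -- F is a family of inputs, of which the choices at levels below ℓ are still open;
    -- e lists the jobs released from r on, namely those of the instance with ℓ
    -- levels, and all other jobs are old.  The old jobs need at least unit ℓ more,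
    -- for whatever choices are made.  Then some choices leave every job with at least
    -- one unit when the stream starts.
    adversary : ∀ ℓ r (F : Bits ℓ → Fin N → Job) (e : Fin (#jobs ℓ) → Fin N) →
      (∀ {i j} → e i ≡ e j → i ≡ j) →
      (∀ β β′ q → release (F β q) ≡ release (F β′ q) × predicted (F β q) ≡ predicted (F β′ q)) →
      (∀ β i → processing (F β (e i)) ≡ ι (proc ℓ β i) × release (F β (e i)) ≡ ι (rel ℓ r i)) →
      (∀ q → (∃[ i ] q ≡ e i) ⊎ (∀ β → Residual (F β) r (unit ℓ) q)) →
      ∃[ β ] ∀ q → Residual (F β) (streamStart ℓ r) 1 q
    adversary zero r F e e-inj same new old = [] , last
      where
      last : ∀ q → Residual (F []) r 1 q
      last q with old q
      ... | inj₂ residual = residual []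
      ... | inj₁ (i , refl) = ≤-reflexive (begin
        work (runOn (F [])) (e i) (ι r) + ι 1
          ≡⟨ cong (_+ ι 1) (work-unreleased (input (F [])) (runOn (F [])) (OnlineAlgorithm.valid ALG _) (e i)
               (≤-trans (ι-mono-≤ (r≤rel zero r i)) (≤-reflexive (sym (proj₂ (new [] i)))))) ⟩
        0# + ι 1                               ≡⟨ 𝔽.+-identityˡ _ ⟩
        ι 1                                    ≡⟨ proj₁ (new [] i) ⟨
        processing (F [] (e i))                ∎)
        where open ≡-Reasoning
    adversary (suc ℓ) r F e e-inj same new old = answer
      where
      r′ = r ℕ.+ short ℓ
      valid = OnlineAlgorithm.valid ALG

      r≤r′ : ι r ≤ ι r′
      r≤r′ = ι-mono-≤ (ℕ.m≤m+n r (short ℓ))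

      old-residual : ∀ β q → Residual (F β) r (unit (suc ℓ)) q → Residual (F β) r′ (unit ℓ) q
      old-residual β q residual = ≤-trans
        (≤-transfer (volume-single (runOn (F β)) q r≤r′) regroup) residual
        where
        open ≡-Reasoning
        regroup : work (runOn (F β)) q (ι r′) + ι (unit ℓ) + (work (runOn (F β)) q (ι r) + ι r′)
                ≡ work (runOn (F β)) q (ι r) + ι (unit (suc ℓ)) + (work (runOn (F β)) q (ι r′) + ι r)
        regroup = begin
          work (runOn (F β)) q (ι r′) + ι (unit ℓ) + (work (runOn (F β)) q (ι r) + ι r′)
            ≡⟨ cong (λ x → work (runOn (F β)) q (ι r′) + ι (unit ℓ) + (work (runOn (F β)) q (ι r) + x))
                 (ι-+ r (short ℓ)) ⟩
          work (runOn (F β)) q (ι r′) + ι (unit ℓ) + (work (runOn (F β)) q (ι r) + (ι r + ι (short ℓ)))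
            ≡⟨ solve 5 (λ w′ u w r s → w′ :+ u :+ (w :+ (r :+ s)) := w :+ (u :+ s) :+ (w′ :+ r)) refl _ _ _ _ _ ⟩
          work (runOn (F β)) q (ι r) + (ι (unit ℓ) + ι (short ℓ)) + (work (runOn (F β)) q (ι r′) + ι r)
            ≡⟨ cong (λ x → work (runOn (F β)) q (ι r) + x + (work (runOn (F β)) q (ι r′) + ι r))
                 (ι-+ (unit ℓ) (short ℓ)) ⟨
          work (runOn (F β)) q (ι r) + ι (unit (suc ℓ)) + (work (runOn (F β)) q (ι r′) + ι r) ∎

      unreleased : ∀ β i {t} → t ≤ ι (rel (suc ℓ) r i) → work (runOn (F β)) (e i) t ≡ 0#
      unreleased β i t≤ = work-unreleased (input (F β)) (runOn (F β)) (valid _) (e i)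
        (≤-trans t≤ (≤-reflexive (sym (proj₂ (new β i)))))

      positive : ∀ β i → 0# < processing (F β (e i))
      positive β i = processing-pos (F β (e i))

      -- A job released at r, of processing time at least short ℓ, is alive before r′.
      pair-alive : ∀ β i → rel (suc ℓ) r i ≡ r → short ℓ ℕ.≤ proc (suc ℓ) β i →
                   ∀ t → t < ι r′ → work (runOn (F β)) (e i) t < processing (F β (e i))
      pair-alive β i rel≡ short≤ t t<r′ with <-≤-total (ι r) t
      ... | inj₂ t≤r = subst (_< processing (F β (e i)))
        (sym (unreleased β i (≤-trans t≤r (≤-reflexive (cong ι (sym rel≡)))))) (positive β i)
      ... | inj₁ r<t = <-≤-trans w<short
        (≤-trans (ι-mono-≤ short≤) (≤-reflexive (sym (proj₁ (new β i)))))
        where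
        open ≤-Reasoning
        w<short : work (runOn (F β)) (e i) t < ι (short ℓ)
        w<short = +-cancelʳ-< (ι r) (begin-strict
          work (runOn (F β)) (e i) t + ι r       ≤⟨ volume-single (runOn (F β)) (e i) (<⇒≤ r<t) ⟩
          work (runOn (F β)) (e i) (ι r) + t     ≡⟨ cong (_+ t) (unreleased β i (≤-reflexive (cong ι (sym rel≡)))) ⟩
          0# + t                                 ≡⟨ 𝔽.+-identityˡ t ⟩
          t                                      <⟨ t<r′ ⟩
          ι r′                                   ≡⟨ trans (cong ι (ℕ.+-comm r _)) (ι-+ (short ℓ) r) ⟩
          ι (short ℓ) + ι r                      ∎)

      alive : ∀ β → NoCompletionBefore (input (F β)) (runOn (F β)) (ι r′)
      alive β q t t<r′ with old q
      ... | inj₂ residual = begin-strict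
        work (runOn (F β)) q t                   ≤⟨ work-mono-≤ (runOn (F β)) q (<⇒≤ t<r′) ⟩
        work (runOn (F β)) q (ι r′)              ≡⟨ 𝔽.+-identityʳ _ ⟨
        work (runOn (F β)) q (ι r′) + 0#         <⟨ +-monoʳ-< _ (ι-mono-< (unit-pos ℓ)) ⟩
        work (runOn (F β)) q (ι r′) + ι (unit ℓ) ≤⟨ old-residual β q (residual β) ⟩
        processing (F β q)                       ∎
        where open ≤-Reasoning
      ... | inj₁ (zero , refl) = pair-alive β zero refl (pred≤proc (suc ℓ) β zero) t t<r′
      ... | inj₁ (suc zero , refl) = pair-alive β (suc zero) refl (pred≤proc (suc ℓ) β (suc zero)) t t<r′
      ... | inj₁ (suc (suc i) , refl) = subst (_< processing (F β (e (suc (suc i)))))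
        (sym (unreleased β (suc (suc i)) (≤-trans (<⇒≤ t<r′) (ι-mono-≤ (r≤rel ℓ r′ i))))) (positive β (suc (suc i)))

      -- The work done up to r′ does not depend on the choices, so it can be read off
      -- from one run.
      reference : Bits (suc ℓ)
      reference = false ∷ replicate ℓ false

      w : Fin (#jobs (suc ℓ)) → ℝ
      w i = work (runOn (F reference)) (e i) (ι r′)

      w≡ : ∀ β i → work (runOn (F β)) (e i) (ι r′) ≡ w i
      w≡ β i =
        indistinguishable ALG (F β) (F reference) (ι r′) (same β reference) (alive β) (alive reference) (e i)

      w₀+w₁≤short : w zero + w (suc zero) ≤ ι (short ℓ)
      w₀+w₁≤short = +-cancelʳ-≤ (ι r) (begin
        w zero + w (suc zero) + ι r
          ≡⟨ cong (_+ ι r) (sumOver-pair e₀≢e₁ _) ⟨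
        sumOver (⁅ e zero ⁆ ∪ ⁅ e (suc zero) ⁆) (λ q → work (runOn (F reference)) q (ι r′)) + ι r
          ≤⟨ volume (runOn (F reference)) (⁅ e zero ⁆ ∪ ⁅ e (suc zero) ⁆) r≤r′ ⟩
        sumOver (⁅ e zero ⁆ ∪ ⁅ e (suc zero) ⁆) (λ q → work (runOn (F reference)) q (ι r)) + ι r′
          ≡⟨ cong (_+ ι r′) (trans (sumOver-pair e₀≢e₁ _)
               (cong₂ _+_ (unreleased reference zero ≤-refl) (unreleased reference (suc zero) ≤-refl))) ⟩
        0# + 0# + ι r′
          ≡⟨ trans (cong (_+ ι r′) (𝔽.+-identityˡ 0#)) (𝔽.+-identityˡ _) ⟩
        ι r′
          ≡⟨ trans (cong ι (ℕ.+-comm r _)) (ι-+ (short ℓ) r) ⟩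
        ι (short ℓ) + ι r ∎)
        where
        open ≤-Reasoning
        e₀≢e₁ : e zero ≢ e (suc zero)
        e₀≢e₁ eq with e-inj eq
        ... | ()

      0≤w : ∀ i → 0# ≤ w i
      0≤w i = subst (_≤ w i) (work-initial (runOn (F reference)) (e i))
                (work-mono-≤ (runOn (F reference)) (e i) (ι-nonneg r′))

      -- The job with less work is made short: at most half of it is done.
      half : ∀ {x y} → x ≤ y → x + y ≤ ι (short ℓ) → x + ι (unit ℓ) ≤ ι (short ℓ)
      half {x} {y} x≤y x+y≤ = halve-≤ (begin
        x + ι (unit ℓ) + (x + ι (unit ℓ))    ≡⟨ solve 2 (λ x u → x :+ u :+ (x :+ u) := x :+ x :+ (u :+ u)) refl _ _ ⟩
        x + x + (ι (unit ℓ) + ι (unit ℓ))    ≤⟨ +-mono-≤ (≤-trans (+-monoʳ-≤ x x≤y) x+y≤)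
                                                 (≤-trans (≤-reflexive (sym (ι-+ (unit ℓ) (unit ℓ))))
                                                   (ι-mono-≤ (2unit≤short ℓ))) ⟩
        ι (short ℓ) + ι (short ℓ)            ∎)
        where open ≤-Reasoning

      -- The other job is made long, and at most short ℓ of it is done.
      full : ∀ {x y} → 0# ≤ x → x + y ≤ ι (short ℓ) → y + ι (unit ℓ) ≤ ι (long ℓ)
      full {x} {y} 0≤x x+y≤ = begin
        y + ι (unit ℓ)            ≡⟨ 𝔽.+-identityˡ _ ⟨
        0# + (y + ι (unit ℓ))     ≤⟨ +-monoˡ-≤ _ 0≤x ⟩
        x + (y + ι (unit ℓ))      ≡⟨ solve 3 (λ x y u → x :+ (y :+ u) := u :+ (x :+ y)) refl _ _ _ ⟩
        ι (unit ℓ) + (x + y)      ≤⟨ +-monoʳ-≤ _ x+y≤ ⟩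
        ι (unit ℓ) + ι (short ℓ)  ≡⟨ ι-+ (unit ℓ) (short ℓ) ⟨
        ι (long ℓ)                ∎
        where open ≤-Reasoning

      choose : ∀ b →
        (∀ β → w zero + ι (unit ℓ) ≤ ι (proc (suc ℓ) (b ∷ β) zero)) →
        (∀ β → w (suc zero) + ι (unit ℓ) ≤ ι (proc (suc ℓ) (b ∷ β) (suc zero))) →
        ∃[ β ] ∀ q → Residual (F β) (streamStart ℓ r′) 1 q
      choose b residual₀ residual₁ with adversary ℓ r′ (λ β → F (b ∷ β)) (λ i → e (suc (suc i)))
        (λ eq → Fin.suc-injective (Fin.suc-injective (e-inj eq)))
        (λ β β′ → same (b ∷ β) (b ∷ β′)) (λ β i → new (b ∷ β) (suc (suc i))) old′
        where
        pair : ∀ i → (∀ β → w i + ι (unit ℓ) ≤ ι (proc (suc ℓ) (b ∷ β) i)) →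
               ∀ β → Residual (F (b ∷ β)) r′ (unit ℓ) (e i)
        pair i residual β = subst₂ (λ x y → x + ι (unit ℓ) ≤ y) (sym (w≡ (b ∷ β) i))
          (sym (proj₁ (new (b ∷ β) i))) (residual β)
        old′ : ∀ q → (∃[ i ] q ≡ e (suc (suc i))) ⊎ (∀ β → Residual (F (b ∷ β)) r′ (unit ℓ) q)
        old′ q with old q
        ... | inj₂ residual                = inj₂ (λ β → old-residual (b ∷ β) q (residual (b ∷ β)))
        ... | inj₁ (zero , refl)           = inj₂ (pair zero residual₀)
        ... | inj₁ (suc zero , refl)       = inj₂ (pair (suc zero) residual₁)
        ... | inj₁ (suc (suc i) , q≡)      = inj₁ (i , q≡)
      ... | β , residual = b ∷ β , residual

      answer : ∃[ β ] ∀ q → Residual (F β) (streamStart ℓ r′) 1 q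
      answer with <-≤-total (w zero) (w (suc zero))
      ... | inj₁ w₀<w₁ = choose false (λ _ → half (<⇒≤ w₀<w₁) w₀+w₁≤short) (λ _ → full (0≤w zero) w₀+w₁≤short)
      ... | inj₂ w₁≤w₀ = choose true (λ _ → full (0≤w (suc zero)) w₁+w₀≤short) (λ _ → half w₁≤w₀ w₁+w₀≤short)
        where
        w₁+w₀≤short = subst (_≤ ι (short ℓ)) (𝔽.+-comm _ _) w₀+w₁≤short

-- Online cost, offline optimum, and their ratio

module LowerBound (R : RealField) where
  open RealField R
  open OrderedField R
  open FiniteSums R
  open SPPT R
  open ScheduleProperties R
  open Adversary R
  open Solver using (solve; _:+_; _:*_; _:=_; con)

  sum-minus : ∀ {m} (f g : Fin m → ℝ) → sum (λ q → f q - g q) + sum g ≡ sum f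
  sum-minus f g = trans (sym (sum-+ _ g)) (sum-cong (λ q → x-z+z≡x (f q) (g q)))

  sum-const : ∀ m a → sum {m} (λ _ → ι a) ≡ ι (m ℕ.* a)
  sum-const zero    a = refl
  sum-const (suc m) a = trans (cong (ι a +_) (sum-const m a)) (sym (ι-+ a (m ℕ.* a)))

  Σ<-toℕ : ∀ m f → Σ< m f ≡ sum {m} (f ∘ toℕ)
  Σ<-toℕ zero    f = refl
  Σ<-toℕ (suc m) f = trans (Σ<-cons m f) (cong (f 0 +_) (Σ<-toℕ m (f ∘ suc)))

  -- If at time T every job q of J still needs at least a q > 0, and all of them are
  -- completed by time t, then the machine works on them for at least Σ a from T to t.
  completed-volume : (Q : Input) (S : Schedule (size Q)) → Valid Q S →
    ∀ {c : Fin (size Q) → ℝ} → (∀ q → CompletesAt Q S q (c q)) →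
    ∀ (J : Subset (size Q)) (a : Fin (size Q) → ℝ) {T t} →
    Nonempty J → (∀ q → 0# < a q) → (∀ q → q ∈ J → work S q T + a q ≤ processing (job Q q)) →
    (∀ q → q ∈ J → c q ≤ t) → T + sumOver J a ≤ t
  completed-volume Q S valid {c} done J a {T} {t} (q₀ , q₀∈J) 0<a residual c≤t =
    ≤-transfer (+-mono-≤ weights (volume S J (<⇒≤ T<t))) (solve 5
      (λ T a w w′ t → T :+ a :+ (w′ :+ (w :+ t)) := t :+ (w :+ a :+ (w′ :+ T))) refl _ _ _ _ _)
    where
    weights : sumOver J (λ q → work S q T) + sumOver J a ≤ sumOver J (λ q → work S q t)
    weights = subst (_≤ sumOver J (λ q → work S q t)) (sumOver-+ J _ a)
      (sumOver-mono-≤ J (λ q q∈J → ≤-trans (residual q q∈J)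
        (processing≤work Q S valid {c = c q} (done q) (c≤t q q∈J))))
    T<t : T < t
    T<t = <-≤-trans (completes-after Q S valid {c = c q₀} (done q₀) (<-≤-trans
      (subst (_< work S q₀ T + a q₀) (𝔽.+-identityʳ _) (+-monoʳ-< _ (0<a q₀))) (residual q₀ q₀∈J)))
      (c≤t q₀ q₀∈J)

  module _ (K n : ℕ) (2≤K : 2 ℕ.≤ K) where
    open Instance K n 2≤K

    -- The jobs of the instance that starts at time 0.
    jobs : ∀ ℓ → Bits ℓ → Fin (#jobs ℓ) → Job
    jobs ℓ β q = record
      { processing     = ι (proc ℓ β q)
      ; release        = ι (rel ℓ 0 q)
      ; predicted      = ι (pred ℓ q)
      ; processing-pos = ι-mono-< (proc-pos ℓ β q)
      ; release-nonneg = ι-nonneg (rel ℓ 0 q)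
      ; predicted-pos  = ι-mono-< (pred-pos ℓ q)
      }

    robust : ∀ {μ} → ι B < ι K * μ → ∀ ℓ β → Robust μ (input (jobs ℓ β))
    robust {μ} B<Kμ ℓ β q = ι-mono-≤ (pred≤proc ℓ β q) , p<μp̃
      where
      0<K : 0# < ι K
      0<K = ι-mono-< (ℕ.≤-trans (s≤s z≤n) 2≤K)
      Kp<Kμp̃ : ι K * ι (proc ℓ β q) < ι K * (μ * ι (pred ℓ q))
      Kp<Kμp̃ = begin-strict
        ι K * ι (proc ℓ β q)       ≡⟨ ι-* K (proc ℓ β q) ⟨
        ι (K ℕ.* proc ℓ β q)       ≤⟨ ι-mono-≤ (K*proc≤B*pred ℓ β q) ⟩
        ι (B ℕ.* pred ℓ q)         ≡⟨ trans (ι-* B (pred ℓ q)) (𝔽.*-comm _ _) ⟩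
        ι (pred ℓ q) * ι B         <⟨ *-monoʳ-< _ (ι-mono-< (pred-pos ℓ q)) B<Kμ ⟩
        ι (pred ℓ q) * (ι K * μ)   ≡⟨ solve 3 (λ p k m → p :* (k :* m) := k :* (m :* p)) refl _ _ _ ⟩
        ι K * (μ * ι (pred ℓ q))   ∎
        where open ≤-Reasoning
      p<μp̃ : ι (proc ℓ β q) < μ * ι (pred ℓ q)
      p<μp̃ with <-≤-total (ι (proc ℓ β q)) (μ * ι (pred ℓ q))
      ... | inj₁ lt = lt
      ... | inj₂ ge = ⊥-elim (≤⇒≯ (*-monoʳ-≤ (ι K) 0<K ge) Kp<Kμp̃)

    private
      swap : ∀ {a b c : ℝ} → b + (a + c) ≡ a + (b + c)
      swap = solve 3 (λ a b c → b :+ (a :+ c) := a :+ (b :+ c)) refl _ _ _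

    -- The jobs occupy the slots below #jobs ℓ, one each.
    Σ<-pos : ∀ ℓ β f → Σ< (#jobs ℓ) f ≡ sum (f ∘ pos ℓ β)
    Σ<-pos zero    []          f = Σ<-toℕ n f
    Σ<-pos (suc ℓ) (b ∷ β) f = begin
      Σ< (suc (#jobs ℓ)) f + f (suc (#jobs ℓ))
        ≡⟨ cong (_+ f (suc (#jobs ℓ))) (Σ<-cons (#jobs ℓ) f) ⟩
      f 0 + Σ< (#jobs ℓ) (f ∘ suc) + f (suc (#jobs ℓ))
        ≡⟨ solve 3 (λ a b c → a :+ b :+ c := a :+ (c :+ b)) refl _ _ _ ⟩
      f 0 + (f (suc (#jobs ℓ)) + Σ< (#jobs ℓ) (f ∘ suc))
        ≡⟨ cong (λ x → f 0 + (f (suc (#jobs ℓ)) + x)) (Σ<-pos ℓ β (f ∘ suc)) ⟩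
      f 0 + (f (suc (#jobs ℓ)) + sum (λ q → f (suc (pos ℓ β q))))
        ≡⟨ order b ⟩
      sum (f ∘ pos (suc ℓ) (b ∷ β)) ∎
      where
      open ≡-Reasoning
      order : ∀ b → f 0 + (f (suc (#jobs ℓ)) + sum (λ q → f (suc (pos ℓ β q)))) ≡ sum (f ∘ pos (suc ℓ) (b ∷ β))
      order false = refl
      order true  = swap

    ι-sum₃ : ∀ a b c → ι a + (ι b + ι c) ≡ ι (a ℕ.+ (b ℕ.+ c))
    ι-sum₃ a b c = trans (cong (ι a +_) (sym (ι-+ b c))) (sym (ι-+ a (b ℕ.+ c)))

    sum-flow : ∀ ℓ β → sum (ι ∘ flow ℓ β) ≡ ι (suc ℓ ℕ.* n ℕ.+ overhead ℓ)
    sum-flow zero [] = trans (sum-const n 1) (cong ι (solveℕ 1 (λ n → n ⊗ κ 1 ⊜ (κ 1 ⊗ n) ⊕ κ 0) refl n))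
    sum-flow (suc ℓ) (b ∷ β) = begin
      sum (ι ∘ flow (suc ℓ) (b ∷ β))
        ≡⟨ order b ⟩
      ι (short ℓ) + (ι (short ℓ ℕ.+ C ℓ (#jobs ℓ) ℕ.+ long ℓ) + sum (ι ∘ flow ℓ β))
        ≡⟨ cong (λ x → ι (short ℓ) + (ι (short ℓ ℕ.+ x ℕ.+ long ℓ) + sum (ι ∘ flow ℓ β))) (C-#jobs ℓ) ⟩
      ι (short ℓ) + (ι (short ℓ ℕ.+ (n ℕ.+ pairWork ℓ) ℕ.+ long ℓ) + sum (ι ∘ flow ℓ β))
        ≡⟨ cong (λ x → ι (short ℓ) + (ι (short ℓ ℕ.+ (n ℕ.+ pairWork ℓ) ℕ.+ long ℓ) + x)) (sum-flow ℓ β) ⟩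
      ι (short ℓ) + (ι (short ℓ ℕ.+ (n ℕ.+ pairWork ℓ) ℕ.+ long ℓ) + ι (suc ℓ ℕ.* n ℕ.+ overhead ℓ))
        ≡⟨ ι-sum₃ (short ℓ) (short ℓ ℕ.+ (n ℕ.+ pairWork ℓ) ℕ.+ long ℓ) (suc ℓ ℕ.* n ℕ.+ overhead ℓ) ⟩
      ι (short ℓ ℕ.+ (short ℓ ℕ.+ (n ℕ.+ pairWork ℓ) ℕ.+ long ℓ ℕ.+ (suc ℓ ℕ.* n ℕ.+ overhead ℓ)))
        ≡⟨ cong ι (solveℕ 6 (λ s n w l m o → s ⊕ (s ⊕ (n ⊕ w) ⊕ l ⊕ (m ⊕ o))
                                    ⊜ n ⊕ m ⊕ (s ⊕ (s ⊕ w ⊕ l) ⊕ o)) refl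
                             (short ℓ) n (pairWork ℓ) (long ℓ) (suc ℓ ℕ.* n) (overhead ℓ)) ⟩
      ι (suc (suc ℓ) ℕ.* n ℕ.+ overhead (suc ℓ)) ∎
      where
      open ≡-Reasoning
      order : ∀ b → sum (ι ∘ flow (suc ℓ) (b ∷ β))
                  ≡ ι (short ℓ) + (ι (short ℓ ℕ.+ C ℓ (#jobs ℓ) ℕ.+ long ℓ) + sum (ι ∘ flow ℓ β))
      order false = refl
      order true  = swap

    sum-delay : ∀ ℓ e β → sum (ι ∘ delay ℓ e β) ≡ ι ((suc e ℕ.+ (ℓ ℕ.+ ℓ)) ℕ.* n)
    sum-delay zero e [] = trans (sum-const n (suc e))
      (cong ι (trans (ℕ.*-comm n (suc e)) (cong (ℕ._* n) (sym (ℕ.+-identityʳ (suc e))))))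
    sum-delay (suc ℓ) e (b ∷ β) = begin
      sum (ι ∘ delay (suc ℓ) e (b ∷ β))
        ≡⟨ order b ⟩
      ι 0 + (ι n + sum (ι ∘ delay ℓ (suc e) β))
        ≡⟨ cong (λ x → ι 0 + (ι n + x)) (sum-delay ℓ (suc e) β) ⟩
      ι 0 + (ι n + ι ((suc (suc e) ℕ.+ (ℓ ℕ.+ ℓ)) ℕ.* n))
        ≡⟨ ι-sum₃ 0 n ((suc (suc e) ℕ.+ (ℓ ℕ.+ ℓ)) ℕ.* n) ⟩
      ι (n ℕ.+ (suc (suc e) ℕ.+ (ℓ ℕ.+ ℓ)) ℕ.* n)
        ≡⟨ cong (λ x → ι (suc x ℕ.* n)) (solveℕ 2 (λ e ℓ → κ 2 ⊕ e ⊕ (ℓ ⊕ ℓ) ⊜ e ⊕ ((κ 1 ⊕ ℓ) ⊕ (κ 1 ⊕ ℓ))) refl e ℓ) ⟩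
      ι ((suc e ℕ.+ (suc ℓ ℕ.+ suc ℓ)) ℕ.* n) ∎
      where
      open ≡-Reasoning
      order : ∀ b → sum (ι ∘ delay (suc ℓ) e (b ∷ β)) ≡ ι 0 + (ι n + sum (ι ∘ delay ℓ (suc e) β))
      order false = refl
      order true  = swap

    sum-proc : ∀ ℓ β → sum (ι ∘ proc ℓ β) ≡ ι (C ℓ (#jobs ℓ))
    sum-proc zero [] = trans (sum-const n 1) (cong ι (trans (ℕ.*-identityʳ n) (sym (C-zero n))))
    sum-proc (suc ℓ) (b ∷ β) = begin
      sum (ι ∘ proc (suc ℓ) (b ∷ β))                    ≡⟨ order b ⟩
      ι (short ℓ) + (ι (long ℓ) + sum (ι ∘ proc ℓ β))   ≡⟨ cong (λ x → ι (short ℓ) + (ι (long ℓ) + x)) (sum-proc ℓ β) ⟩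
      ι (short ℓ) + (ι (long ℓ) + ι (C ℓ (#jobs ℓ)))    ≡⟨ ι-sum₃ (short ℓ) (long ℓ) (C ℓ (#jobs ℓ)) ⟩
      ι (short ℓ ℕ.+ (long ℓ ℕ.+ C ℓ (#jobs ℓ)))        ≡⟨ cong ι (trans (cong (short ℓ ℕ.+_) (ℕ.+-comm (long ℓ) _))
                                                               (sym (ℕ.+-assoc (short ℓ) _ _))) ⟩
      ι (short ℓ ℕ.+ C ℓ (#jobs ℓ) ℕ.+ long ℓ)          ≡⟨ cong ι (C-last ℓ) ⟨
      ι (C (suc ℓ) (#jobs (suc ℓ)))                     ∎
      where
      open ≡-Reasoning
      order : ∀ b → sum (ι ∘ proc (suc ℓ) (b ∷ β)) ≡ ι (short ℓ) + (ι (long ℓ) + sum (ι ∘ proc ℓ β))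
      order false = refl
      order true  = swap

    online-flow : ∀ ℓ β (S : Schedule (#jobs ℓ)) → let Q = input (jobs ℓ β) in Valid Q S →
      (∀ q → work S q (ι (streamStart ℓ 0)) + ι 1 ≤ processing (job Q q)) →
      ∀ F → TotalFlow Q S F → ι (suc (ℓ ℕ.+ ℓ) ℕ.* n) ≤ F
    online-flow ℓ β S valid residual F (c , done , F≡) = +-cancelʳ-≤ (sum (ι ∘ rel ℓ 0)) (begin
      ι (suc (ℓ ℕ.+ ℓ) ℕ.* n) + sum (ι ∘ rel ℓ 0)      ≡⟨ cong (_+ sum (ι ∘ rel ℓ 0)) (sum-delay ℓ 0 β) ⟨
      sum (ι ∘ delay ℓ 0 β) + sum (ι ∘ rel ℓ 0)        ≡⟨ sum-+ (ι ∘ delay ℓ 0 β) (ι ∘ rel ℓ 0) ⟨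
      sum (λ q → ι (delay ℓ 0 β q) + ι (rel ℓ 0 q))    ≤⟨ sum-mono-≤ (λ q → ≤-trans
                                                            (≤-reflexive (trans (𝔽.+-comm _ _) (sym (ι-+ (rel ℓ 0 q) _))))
                                                            (ι-mono-≤ (delay-≤ ℓ 0 0 β q))) ⟩
      sum (λ q → g (suc (pos ℓ β q)))                  ≡⟨ Σ<-pos ℓ β (g ∘ suc) ⟨
      Σ< (#jobs ℓ) (g ∘ suc)                           ≤⟨ sum-≥ c g late ⟩
      sum c                                            ≡⟨ sum-minus c (ι ∘ rel ℓ 0) ⟨
      sum (λ q → c q - ι (rel ℓ 0 q)) + sum (ι ∘ rel ℓ 0) ≡⟨ cong (_+ sum (ι ∘ rel ℓ 0)) F≡ ⟨
      F + sum (ι ∘ rel ℓ 0)                            ∎)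
      where
      open ≤-Reasoning
      g : ℕ → ℝ
      g j = ι (streamStart ℓ 0 ℕ.+ j)
      late : ∀ J t → Nonempty J → (∀ q → q ∈ J → c q ≤ t) → g ∣ J ∣ ≤ t
      late J t ne c≤t = subst (_≤ t)
        (trans (cong (ι (streamStart ℓ 0) +_) (sumOver-1 J)) (sym (ι-+ (streamStart ℓ 0) ∣ J ∣)))
        (completed-volume (input (jobs ℓ β)) S valid {c} done J (λ _ → 1#) ne (λ _ → 0<1)
          (λ q _ → subst (λ x → work S q (ι (streamStart ℓ 0)) + x ≤ ι (proc ℓ β q)) ι-1 (residual q)) c≤t)

    -- The constraint that release times and processing times put on the completion
    -- times c of any schedule: a set of jobs released from time s on is not completed
    -- before s plus the total of their processing times.
    Feasible : ∀ ℓ → ℕ → Bits ℓ → (Fin (#jobs ℓ) → ℝ) → Set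
    Feasible ℓ r β c = ∀ s J t → Nonempty J → (∀ q → q ∈ J → s ℕ.≤ rel ℓ r q) → (∀ q → q ∈ J → c q ≤ t) →
                       ι s + sumOver J (ι ∘ proc ℓ β) ≤ t

    -- No schedule completes j jobs before the end of the j-th slot of the offline
    -- schedule.  If J contains at most one job of the first pair, the bound for
    -- the remaining levels applies from r + short ℓ on; if it contains both, they
    -- take so much time that counting each other job as one unit suffices, unless
    -- J contains all jobs.
    feasible-late : ∀ ℓ r β c → Feasible ℓ r β c → ∀ J t → Nonempty J → (∀ q → q ∈ J → c q ≤ t) →
                    ι (r ℕ.+ C ℓ ∣ J ∣) ≤ t
    feasible-late zero r [] c feasible J t ne c≤t = subst (_≤ t) eq
      (feasible r J t ne (λ q _ → r≤rel zero r q) c≤t)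
      where
      open ≡-Reasoning
      eq : ι r + sumOver J (λ _ → ι 1) ≡ ι (r ℕ.+ C zero ∣ J ∣)
      eq = begin
        ι r + sumOver J (λ _ → ι 1)   ≡⟨ cong (ι r +_) (sumOver-cong J (λ _ → ι-1)) ⟩
        ι r + sumOver J (λ _ → 1#)    ≡⟨ cong (ι r +_) (sumOver-1 J) ⟩
        ι r + ι ∣ J ∣                 ≡⟨ ι-+ r ∣ J ∣ ⟨
        ι (r ℕ.+ ∣ J ∣)               ≡⟨ cong (λ x → ι (r ℕ.+ x)) (C-zero ∣ J ∣) ⟨
        ι (r ℕ.+ C zero ∣ J ∣)        ∎
    feasible-late (suc ℓ) r (b ∷ β) c feasible (x₀ ∷ x₁ ∷ J) t ne c≤t = byPair x₀ x₁ ne c≤t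
      where
      open ≤-Reasoning

      inner : Nonempty J → (∀ q → q ∈ J → c (suc (suc q)) ≤ t) → ι (r ℕ.+ short ℓ ℕ.+ C ℓ ∣ J ∣) ≤ t
      inner ne c≤t = feasible-late ℓ (r ℕ.+ short ℓ) β (λ q → c (suc (suc q)))
        (λ { s J t (q , q∈J) s≤ c≤ → feasible s (outside ∷ outside ∷ J) t (suc (suc q) , there (there q∈J))
               (λ { (suc (suc q)) (there (there q∈J)) → s≤ q q∈J })
               (λ { (suc (suc q)) (there (there q∈J)) → c≤ q q∈J }) })
        J t ne c≤t

      afterPair : ι (r ℕ.+ short ℓ ℕ.+ C ℓ ∣ J ∣) ≤ t → ι (r ℕ.+ C (suc ℓ) (suc ∣ J ∣)) ≤ t
      afterPair = subst (λ x → ι x ≤ t) (trans (ℕ.+-assoc r _ _)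
        (cong (r ℕ.+_) (sym (C-shift ℓ ∣ J ∣ (Subset.∣p∣≤n J)))))

      fromStart : ∀ x₀ x₁ → Nonempty (x₀ ∷ x₁ ∷ J) → (∀ q → q ∈ (x₀ ∷ x₁ ∷ J) → c q ≤ t) →
                  ι r + sumOver (x₀ ∷ x₁ ∷ J) (ι ∘ proc (suc ℓ) (b ∷ β)) ≤ t
      fromStart x₀ x₁ ne c≤t = feasible r (x₀ ∷ x₁ ∷ J) t ne (λ q _ → r≤rel (suc ℓ) r q) c≤t

      J-nonneg : ∀ {x} → x ≤ x + sumOver J (ι ∘ proc ℓ β)
      J-nonneg {x} = subst (_≤ x + sumOver J (ι ∘ proc ℓ β))
        (trans (cong (x +_) (sumOver-0 J)) (𝔽.+-identityʳ x))
        (+-monoʳ-≤ x (sumOver-mono-≤ J (λ q _ → ι-nonneg (proc ℓ β q))))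

      one : ∀ {p} → short ℓ ℕ.≤ p → ι r + (ι p + sumOver J (ι ∘ proc ℓ β)) ≤ t →
            (∀ q → q ∈ J → c (suc (suc q)) ≤ t) → ι (r ℕ.+ C (suc ℓ) (suc ∣ J ∣)) ≤ t
      one {p} short≤p busy c≤t with empty-or-nonempty J
      ... | inj₂ ne = afterPair (inner ne c≤t)
      ... | inj₁ ∣J∣≡0 = begin
        ι (r ℕ.+ C (suc ℓ) (suc ∣ J ∣))             ≡⟨ cong (λ k → ι (r ℕ.+ C (suc ℓ) (suc k))) ∣J∣≡0 ⟩
        ι (r ℕ.+ short ℓ)                           ≡⟨ ι-+ r (short ℓ) ⟩
        ι r + ι (short ℓ)                           ≤⟨ +-monoʳ-≤ (ι r) (≤-trans (ι-mono-≤ short≤p) J-nonneg) ⟩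
        ι r + (ι p + sumOver J (ι ∘ proc ℓ β))      ≤⟨ busy ⟩
        t                                           ∎

      C≤work : ι (C (suc ℓ) (suc (suc ∣ J ∣))) ≤ ι (short ℓ) + (ι (long ℓ) + sumOver J (ι ∘ proc ℓ β))
      C≤work with ℕ.m≤n⇒m<n∨m≡n (Subset.∣p∣≤n J)
      ... | inj₁ ∣J∣< = begin
        ι (C (suc ℓ) (suc (suc ∣ J ∣)))                    ≤⟨ ι-mono-≤ (C-suc-suc-≤ ℓ ∣ J ∣ ∣J∣<) ⟩
        ι (short ℓ ℕ.+ long ℓ ℕ.+ ∣ J ∣)                   ≡⟨ cong ι (ℕ.+-assoc (short ℓ) _ _) ⟩
        ι (short ℓ ℕ.+ (long ℓ ℕ.+ ∣ J ∣))                 ≡⟨ ι-sum₃ (short ℓ) (long ℓ) ∣ J ∣ ⟨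
        ι (short ℓ) + (ι (long ℓ) + ι ∣ J ∣)               ≡⟨ cong (λ x → ι (short ℓ) + (ι (long ℓ) + x)) (sumOver-1 J) ⟨
        ι (short ℓ) + (ι (long ℓ) + sumOver J (λ _ → 1#))  ≤⟨ +-monoʳ-≤ _ (+-monoʳ-≤ _ (sumOver-mono-≤ J λ q _ →
                                                               subst (_≤ ι (proc ℓ β q)) ι-1 (ι-mono-≤ (proc-pos ℓ β q)))) ⟩
        ι (short ℓ) + (ι (long ℓ) + sumOver J (ι ∘ proc ℓ β)) ∎
      ... | inj₂ ∣J∣≡ = ≤-reflexive (begin-equality
        ι (C (suc ℓ) (suc (suc ∣ J ∣)))                    ≡⟨ cong (λ k → ι (C (suc ℓ) (suc (suc k)))) ∣J∣≡ ⟩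
        ι (C (suc ℓ) (#jobs (suc ℓ)))                      ≡⟨ sum-proc (suc ℓ) (false ∷ β) ⟨
        ι (short ℓ) + (ι (long ℓ) + sum (ι ∘ proc ℓ β))    ≡⟨ cong (λ x → ι (short ℓ) + (ι (long ℓ) + x))
                                                               (trans (sym (sumOver-⊤ (ι ∘ proc ℓ β)))
                                                                 (cong (λ J → sumOver J (ι ∘ proc ℓ β))
                                                                   (sym (Subset.∣p∣≡n⇒p≡⊤ {p = J} ∣J∣≡)))) ⟩
        ι (short ℓ) + (ι (long ℓ) + sumOver J (ι ∘ proc ℓ β)) ∎)

      both : ∀ b → ι r + sumOver (inside ∷ inside ∷ J) (ι ∘ proc (suc ℓ) (b ∷ β)) ≤ t →
             ι (r ℕ.+ C (suc ℓ) (suc (suc ∣ J ∣))) ≤ t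
      both false busy = begin
        ι (r ℕ.+ C (suc ℓ) (suc (suc ∣ J ∣)))                        ≡⟨ ι-+ r _ ⟩
        ι r + ι (C (suc ℓ) (suc (suc ∣ J ∣)))                        ≤⟨ +-monoʳ-≤ (ι r) C≤work ⟩
        ι r + (ι (short ℓ) + (ι (long ℓ) + sumOver J (ι ∘ proc ℓ β))) ≤⟨ busy ⟩
        t                                                            ∎
      both true busy = both false (subst (λ x → ι r + x ≤ t) swap busy)

      byPair : ∀ x₀ x₁ → Nonempty (x₀ ∷ x₁ ∷ J) → (∀ q → q ∈ (x₀ ∷ x₁ ∷ J) → c q ≤ t) →
               ι (r ℕ.+ C (suc ℓ) ∣ x₀ ∷ x₁ ∷ J ∣) ≤ t
      byPair inside inside ne c≤t = both b (fromStart inside inside ne c≤t)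
      byPair inside outside ne c≤t = one (pred≤proc (suc ℓ) (b ∷ β) zero) (fromStart inside outside ne c≤t)
        (λ q q∈J → c≤t _ (there (there q∈J)))
      byPair outside inside ne c≤t = one (pred≤proc (suc ℓ) (b ∷ β) (suc zero)) (fromStart outside inside ne c≤t)
        (λ q q∈J → c≤t _ (there (there q∈J)))
      byPair outside outside (suc (suc q) , there (there q∈J)) c≤t = begin
        ι (r ℕ.+ C (suc ℓ) ∣ J ∣)            ≤⟨ ι-mono-≤ (ℕ.+-monoʳ-≤ r (ℕ.<⇒≤ (C-< (suc ℓ) ∣ J ∣))) ⟩
        ι (r ℕ.+ C (suc ℓ) (suc ∣ J ∣))      ≤⟨ afterPair (inner (q , q∈J) (λ q q∈J → c≤t _ (there (there q∈J)))) ⟩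
        t                                    ∎

    module Offline (ℓ : ℕ) (β : Bits ℓ) where

      Q : Input
      Q = input (jobs ℓ β)

      offline : Schedule (#jobs ℓ)
      offline = record
        { cut           = λ j → ι (C ℓ j)
        ; cut-zero      = refl
        ; cut-mono      = λ j → ι-mono-< (C-< ℓ j)
        ; cut-unbounded = λ t → let (j , t<j) = archimedean 1# t 0<1 in j , <-≤-trans t<j (ι-mono-≤ (j≤C ℓ j))
        ; slot          = slot ℓ β
        }
      open Schedule offline using (cut; workIn; slotWork)

      -- The times at which the offline schedule starts and completes a job.
      start finish : Fin (#jobs ℓ) → ℝ
      start  q = ι (C ℓ (pos ℓ β q))
      finish q = ι (C ℓ (suc (pos ℓ β q)))

      start+p≡finish : ∀ q → ι (proc ℓ β q) + start q ≡ finish q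
      start+p≡finish q = trans (𝔽.+-comm _ _)
        (trans (cong (λ x → start q + ι x) (proc≡dur ℓ β q)) (sym (ι-+ (C ℓ (pos ℓ β q)) (dur ℓ (pos ℓ β q)))))

      work-before : ∀ q {t} → t ≤ start q → work offline q t ≡ 0#
      work-before q {t} t≤ = trans (work≡workIn offline (pos ℓ β q) q t t≤) (upTo (pos ℓ β q) ℕ.≤-refl)
        where
        upTo : ∀ k → k ℕ.≤ pos ℓ β q → workIn k q t ≡ 0#
        upTo zero    _  = refl
        upTo (suc k) k< = trans (cong₂ _+_ (upTo k (ℕ.<⇒≤ k<))
          (slotWork-zero offline (slot ℓ β k) q (λ eq → ⊥-elim (ℕ.<⇒≢ k< (pos-slot ℓ β k q eq)))))
          (𝔽.+-identityʳ 0#)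

      work-during : ∀ q {t} → start q ≤ t → t ≤ finish q → work offline q t ≡ t - start q
      work-during q {t} ≤t t≤ = begin
        work offline q t
          ≡⟨ work-within offline (pos ℓ β q) q ≤-refl ≤t t≤ ⟩
        work offline q (start q) + slotWork (slot ℓ β (pos ℓ β q)) q (t - start q)
          ≡⟨ cong₂ _+_ (work-before q ≤-refl) (cong (λ d → slotWork d q (t - start q)) (slot-pos ℓ β q)) ⟩
        0# + slotWork (just q) q (t - start q)
          ≡⟨ trans (𝔽.+-identityˡ _) (slotWork-own offline q _) ⟩
        t - start q ∎
        where open ≡-Reasoning

      work-unfinished : ∀ q {t} → t < finish q → work offline q t < ι (proc ℓ β q)
      work-unfinished q {t} t< with <-≤-total (start q) t
      ... | inj₂ t≤ = subst (_< ι (proc ℓ β q)) (sym (work-before q t≤)) (ι-mono-< (proc-pos ℓ β q))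
      ... | inj₁ <t = subst (_< ι (proc ℓ β q)) (sym (work-during q (<⇒≤ <t) (<⇒≤ t<)))
        (subst (t - start q <_) (sym (x+y≡z⇒x≡z-y (start+p≡finish q))) (+-monoˡ-< (- start q) t<))

      offline-valid : Valid Q offline
      offline-valid t q (k , ≤t , t< , eq) with pos-slot ℓ β k q eq
      ... | refl = ≤-trans (ι-mono-≤ (rel≤start ℓ 0 β q)) ≤t , work-unfinished q t<

      completesAt : ∀ q → CompletesAt Q offline q (finish q)
      completesAt q =
        trans (work-during q (ι-mono-≤ (ℕ.<⇒≤ (C-< ℓ (pos ℓ β q)))) ≤-refl) (sym (x+y≡z⇒x≡z-y (start+p≡finish q)))
        , λ t t< → work-unfinished q t<

      -- The total flow time of the offline schedule.
      opt : ℕ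
      opt = suc ℓ ℕ.* n ℕ.+ overhead ℓ

      offline-flow : ι opt ≡ sum (λ q → finish q - ι (rel ℓ 0 q))
      offline-flow = trans (sym (sum-flow ℓ β)) (sum-cong (λ q → x+y≡z⇒x≡z-y (begin
        ι (flow ℓ β q) + ι (rel ℓ 0 q)     ≡⟨ trans (𝔽.+-comm _ _) (sym (ι-+ (rel ℓ 0 q) _)) ⟩
        ι (rel ℓ 0 q ℕ.+ flow ℓ β q)       ≡⟨ cong ι (completion ℓ 0 β q) ⟨
        finish q                           ∎)))
        where open ≡-Reasoning

      isOPT : IsOPT Q (ι opt)
      isOPT = (offline , offline-valid , finish , completesAt , offline-flow) , optimal
        where
        optimal : ∀ S w → Valid Q S → TotalFlow Q S w → ι opt ≤ w
        optimal S w valid (c , done , w≡) = +-cancelʳ-≤ (sum (ι ∘ rel ℓ 0)) (begin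
          ι opt + sum (ι ∘ rel ℓ 0)                                       ≡⟨ cong (_+ sum (ι ∘ rel ℓ 0)) offline-flow ⟩
          sum (λ q → finish q - ι (rel ℓ 0 q)) + sum (ι ∘ rel ℓ 0)        ≡⟨ sum-minus finish _ ⟩
          sum finish                                                      ≡⟨ Σ<-pos ℓ β (λ j → ι (C ℓ (suc j))) ⟨
          Σ< (#jobs ℓ) (λ j → ι (C ℓ (suc j)))                            ≤⟨ sum-≥ c (ι ∘ C ℓ) (feasible-late ℓ 0 β c feasible) ⟩
          sum c                                                           ≡⟨ sum-minus c _ ⟨
          sum (λ q → c q - ι (rel ℓ 0 q)) + sum (ι ∘ rel ℓ 0)             ≡⟨ cong (_+ sum (ι ∘ rel ℓ 0)) w≡ ⟨
          w + sum (ι ∘ rel ℓ 0)                                           ∎)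
          where
          open ≤-Reasoning
          feasible : Feasible ℓ 0 β c
          feasible s J t ne s≤ c≤t = completed-volume Q S valid {c} done J (ι ∘ proc ℓ β) ne
            (λ q → ι-mono-< (proc-pos ℓ β q))
            (λ q q∈J → ≤-reflexive (trans (cong (_+ ι (proc ℓ β q))
              (work-unreleased Q S valid q (ι-mono-≤ (s≤ q q∈J)))) (𝔽.+-identityˡ _)))
            c≤t

    worst-case : (ALG : OnlineAlgorithm) → ∀ ℓ → ∃[ β ]
      ∀ F → TotalFlow (input (jobs ℓ β)) (run ALG (input (jobs ℓ β))) F → ι (suc (ℓ ℕ.+ ℓ) ℕ.* n) ≤ F
    worst-case ALG ℓ with adversary K n 2≤K ALG ℓ 0 (jobs ℓ) (λ i → i) (λ eq → eq)
      (λ _ _ _ → refl , refl) (λ _ _ → refl , refl) (λ q → inj₁ (q , refl))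
    ... | β , residual = β , online-flow ℓ β (run ALG _) (OnlineAlgorithm.valid ALG _) residual

  ι*x≡n·x : ∀ m x → ι m * x ≡ m · x
  ι*x≡n·x m x = trans (SemiringMult.×-assoc-* 𝔽.semiring m 1# x) (cong (m ·_) (𝔽.*-identityˡ x))

  0<y-x : ∀ {x y} → x < y → 0# < y - x
  0<y-x {x} {y} x<y = subst (_< y - x) (x-x≡0 x) (+-monoˡ-< (- x) x<y)

  -- Some fraction (K + 1) / K lies below μ.
  small-distortion : ∀ {μ} → 1# < μ → ∃[ K ] 2 ℕ.≤ K × ι (suc K) < ι K * μ
  small-distortion {μ} 1<μ with archimedean (μ - 1#) 1# (0<y-x 1<μ)
  ... | j , 1<j·d = K , s≤s (s≤s z≤n) , (begin-strict
    1# + ι K                     <⟨ +-monoˡ-< (ι K) 1<Kd ⟩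
    ι K * (μ - 1#) + ι K         ≡⟨ cong (ι K * (μ - 1#) +_) (𝔽.*-identityʳ (ι K)) ⟨
    ι K * (μ - 1#) + ι K * 1#    ≡⟨ 𝔽.distribˡ (ι K) _ _ ⟨
    ι K * (μ - 1# + 1#)          ≡⟨ cong (ι K *_) (x-z+z≡x μ 1#) ⟩
    ι K * μ                      ∎)
    where
    open ≤-Reasoning
    K = suc (suc j)
    1<Kd : 1# < ι K * (μ - 1#)
    1<Kd = begin-strict
      1#                 <⟨ 1<j·d ⟩
      j · (μ - 1#)       ≡⟨ ι*x≡n·x j _ ⟨
      ι j * (μ - 1#)     ≡⟨ 𝔽.*-comm _ _ ⟩
      (μ - 1#) * ι j     ≤⟨ *-monoʳ-≤ _ (0<y-x 1<μ) (ι-mono-≤ (ℕ.m≤n⇒m≤1+n (ℕ.n≤1+n j))) ⟩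
      (μ - 1#) * ι K     ≡⟨ 𝔽.*-comm _ _ ⟩
      ι K * (μ - 1#)     ∎

  -- Writing e = 2 - c and v for the offline cost, c v = 2 v - e v, where 2 v is at
  -- most (2k+3) n and e v exceeds 2 n.
  ratio : ∀ {c} k A → 1# + 1# < k · (1# + 1# - c) → let n = suc (A ℕ.+ A) in
          c < 1# + 1# → c * ι (suc k ℕ.* n ℕ.+ A) < ι (suc (k ℕ.+ k) ℕ.* n)
  ratio {c} k A 2<ke c<2 = +-cancelʳ-< (ι (n ℕ.+ n)) (begin-strict
    c * v + ι (n ℕ.+ n)                      <⟨ +-monoʳ-< (c * v) 2n<ev ⟩
    c * v + e * v                            ≡⟨ 𝔽.distribʳ v c e ⟨
    (c + e) * v                              ≡⟨ cong (_* v) (trans (𝔽.+-comm c e) (x-z+z≡x _ c)) ⟩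
    (1# + 1#) * v                            ≡⟨ trans (𝔽.distribʳ v 1# 1#) (cong₂ _+_ (𝔽.*-identityˡ v) (𝔽.*-identityˡ v)) ⟩
    v + v                                    ≡⟨ ι-+ V V ⟨
    ι (V ℕ.+ V)                              ≤⟨ ι-mono-≤ 2V≤ ⟩
    ι (suc (k ℕ.+ k) ℕ.* n ℕ.+ (n ℕ.+ n))    ≡⟨ ι-+ (suc (k ℕ.+ k) ℕ.* n) _ ⟩
    ι (suc (k ℕ.+ k) ℕ.* n) + ι (n ℕ.+ n)    ∎)
    where
    open ≤-Reasoning
    n = suc (A ℕ.+ A)
    V = suc k ℕ.* n ℕ.+ A
    v = ι V
    e = 1# + 1# - c

    2n<ev : ι (n ℕ.+ n) < e * v
    2n<ev = begin-strict
      ι (n ℕ.+ n)            ≡⟨ trans (ι-+ n n) (sym (cong₂ _+_ (𝔽.*-identityʳ (ι n)) (𝔽.*-identityʳ (ι n)))) ⟩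
      ι n * 1# + ι n * 1#    ≡⟨ 𝔽.distribˡ (ι n) 1# 1# ⟨
      ι n * (1# + 1#)        <⟨ *-monoʳ-< (ι n) (ι-mono-< {0} {n} (s≤s z≤n)) 2<ke ⟩
      ι n * (k · e)          ≡⟨ cong (ι n *_) (ι*x≡n·x k e) ⟨
      ι n * (ι k * e)        ≡⟨ solve 3 (λ n k e → n :* (k :* e) := e :* (k :* n)) refl _ _ _ ⟩
      e * (ι k * ι n)        ≡⟨ cong (e *_) (ι-* k n) ⟨
      e * ι (k ℕ.* n)        ≤⟨ *-monoʳ-≤ e (0<y-x c<2) (ι-mono-≤ (ℕ.≤-trans (ℕ.m≤n+m (k ℕ.* n) n) (ℕ.m≤m+n _ A))) ⟩
      e * v                  ∎

    2V≤ : V ℕ.+ V ℕ.≤ suc (k ℕ.+ k) ℕ.* n ℕ.+ (n ℕ.+ n)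
    2V≤ = ℕ.≤-trans
      (ℕ.≤-reflexive (solveℕ 3 (λ k n A → (κ 1 ⊕ k) ⊗ n ⊕ A ⊕ ((κ 1 ⊕ k) ⊗ n ⊕ A)
         ⊜ (κ 1 ⊕ (k ⊕ k)) ⊗ n ⊕ (n ⊕ (A ⊕ A))) refl k n A))
      (ℕ.+-monoʳ-≤ (suc (k ℕ.+ k) ℕ.* n) (ℕ.+-monoʳ-≤ n (ℕ.n≤1+n (A ℕ.+ A))))

theoremC1 : (R : RealField) → let open RealField R in let open SPPT R in
    (μ : ℝ) → 1# < μ → (ALG : OnlineAlgorithm) → (c : ℝ) → c < 1# + 1# →
    Σ[ Q ∈ Input ] Robust μ Q × (∃[ opt ] IsOPT Q opt × TotalFlowExceeds Q (run ALG Q) (c * opt))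
theoremC1 R μ 1<μ ALG c c<2 =
  let open RealField R
      open OrderedField R
      open LowerBound R
      K , 2≤K , B<Kμ = small-distortion 1<μ
      k , 2<ke       = archimedean (1# + 1# - c) (1# + 1#) (0<y-x c<2)
      A              = Scales.overhead K 2≤K k
      n              = suc (A ℕ.+ A)
      β , slow       = worst-case K n 2≤K ALG k
  in  Offline.Q K n 2≤K k β
    , robust K n 2≤K B<Kμ k β
    , ι (Offline.opt K n 2≤K k β)
    , Offline.isOPT K n 2≤K k β
    , λ F flow → <-≤-trans (ratio k A 2<ke c<2) (slow F flow)
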